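{- For any integer $d\ge 2$ and any integer $i$ with $0\le i\le d-1$, $$\lim_{k\to\infty}\ \zeta(k)^{ -1}\sum_{\substack{2\le r\le k-1\\ r\equiv i \bmod d}}\zeta(r,k-r)\;=\;\sum_{\substack{j\ge 2\\ j\equiv i\bmod d}}\bigl(\zeta(j)-1\bigr),$$ where $k$ runs over the positive integers.
   Context: For integers $r\ge2$, $s\ge1$, the double zeta value is $\zeta(r,s)=\sum_{m>n>0}\frac{1}{m^r n^s}$ (sum over integers); $\zeta(k)$ is the Riemann zeta value. -}

module Defs where

open import Data.Integer.Base as ℤ using (+_; +[1+_])
import Data.Integer.Properties as ℤ
import Data.Integer.Solver as ℤSolver
open import Data.Nat.Base as ℕ using (ℕ; zero; suc; z≤n; s≤s)
import Data.Nat.Properties as ℕ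
open import Data.Nat.Divisibility using (_∣_; _∣?_)
open import Data.Product.Base using (Σ; ∃; _×_; _,_; proj₁; proj₂)
open import Data.Rational.Base as ℚ using (ℚ; mkℚ; 0ℚ; 1ℚ; ½; 1/_; toℚᵘ)
import Data.Rational.Properties as ℚ
import Data.Rational.Solver as ℚSolver
open import Data.Rational.Unnormalised.Base as ℚᵘ using (ℚᵘ; mkℚᵘ)
import Data.Rational.Unnormalised.Properties as ℚᵘ
open import Data.Sum.Base using (inj₁; inj₂)
open import Relation.Binary.PropositionalEquality
open import Relation.Nullary.Decidable using (Dec; yes; no; recompute; _×-dec_)
open import Relation.Unary using (Pred; Decidable)
open import Level using (0ℓ)

private
  module QS = ℚSolver.+-*-Solver
  module ZS = ℤSolver.+-*-Solver

IsCauchy : (ℕ → ℚ) → Set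
IsCauchy x = ∀ ε → 0ℚ ℚ.< ε →
  ∃ λ N → ∀ m n → N ℕ.≤ m → N ℕ.≤ n → ℚ.∣ x m ℚ.- x n ∣ ℚ.≤ ε

-- Real numbers are Cauchy sequences of rationals. Order and limits respect
-- the equality lim x = lim y, which is not needed as a relation of its own.
record ℝ : Set where
  constructor mkℝ
  field
    seq    : ℕ → ℚ
    cauchy : IsCauchy seq

open ℝ public

module RationalLemmas where
  *-mono : ∀ {a b c d} → 0ℚ ℚ.≤ a → 0ℚ ℚ.≤ d → a ℚ.≤ b → c ℚ.≤ d →
           a ℚ.* c ℚ.≤ b ℚ.* d
  *-mono {a} {b} {c} {d} 0≤a 0≤d a≤b c≤d = ℚ.≤-trans
    (ℚ.*-monoˡ-≤-nonNeg a {{ℚ.nonNegative 0≤a}} c≤d)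
    (ℚ.*-monoʳ-≤-nonNeg d {{ℚ.nonNegative 0≤d}} a≤b)

  0≤* : ∀ {a b} → 0ℚ ℚ.≤ a → 0ℚ ℚ.≤ b → 0ℚ ℚ.≤ a ℚ.* b
  0≤* {a} {b} 0≤a 0≤b = ℚ.nonNegative⁻¹ (a ℚ.* b)
    {{ℚ.nonNeg*nonNeg⇒nonNeg a {{ℚ.nonNegative 0≤a}} b {{ℚ.nonNegative 0≤b}}}}

  0<* : ∀ {a b} → 0ℚ ℚ.< a → 0ℚ ℚ.< b → 0ℚ ℚ.< a ℚ.* b
  0<* {a} {b} 0<a 0<b = ℚ.positive⁻¹ (a ℚ.* b)
    {{ℚ.pos*pos⇒pos a {{ℚ.positive 0<a}} b {{ℚ.positive 0<b}}}}

  0<½ : 0ℚ ℚ.< ½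
  0<½ = ℚ.positive⁻¹ ½

  0≤1 : 0ℚ ℚ.≤ 1ℚ
  0≤1 = ℚ.nonNegative⁻¹ 1ℚ

  0<1 : 0ℚ ℚ.< 1ℚ
  0<1 = ℚ.positive⁻¹ 1ℚ

  half+half : ∀ ε → ε ℚ.* ½ ℚ.+ ε ℚ.* ½ ≡ ε
  half+half ε = trans (sym (ℚ.*-distribˡ-+ ε ½ ½)) (ℚ.*-identityʳ ε)

  ∣-∣-bound : ∀ {a b ε} → a ℚ.≤ b ℚ.+ ε → b ℚ.≤ a ℚ.+ ε → ℚ.∣ a ℚ.- b ∣ ℚ.≤ ε
  ∣-∣-bound {a} {b} {ε} h k with ℚ.∣p∣≡p∨∣p∣≡-p (a ℚ.- b)
  ... | inj₁ e = subst (ℚ._≤ ε) (sym e) (subst (a ℚ.- b ℚ.≤_)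
          (QS.solve 2 (λ b e → (b QS.:+ e) QS.:+ (QS.:- b) QS.:= e) refl b ε)
          (ℚ.+-monoˡ-≤ (ℚ.- b) h))
  ... | inj₂ e = subst (ℚ._≤ ε) (sym e) (subst₂ ℚ._≤_
          (QS.solve 2 (λ a b → b QS.:+ (QS.:- a) QS.:= QS.:- (a QS.:+ (QS.:- b))) refl a b)
          (QS.solve 2 (λ a e → (a QS.:+ e) QS.:+ (QS.:- a) QS.:= e) refl a ε)
          (ℚ.+-monoˡ-≤ (ℚ.- a) k))

  ∣∣-sym : ∀ a b → ℚ.∣ a ℚ.- b ∣ ≡ ℚ.∣ b ℚ.- a ∣
  ∣∣-sym a b = trans (sym (ℚ.∣-p∣≡∣p∣ (a ℚ.- b))) (cong ℚ.∣_∣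
    (QS.solve 2 (λ a b → QS.:- (a QS.:+ (QS.:- b)) QS.:= b QS.:+ (QS.:- a)) refl a b))

  p≤∣p∣ : ∀ p → p ℚ.≤ ℚ.∣ p ∣
  p≤∣p∣ p with ℚ.≤-total 0ℚ p
  ... | inj₁ h = ℚ.≤-reflexive (sym (ℚ.0≤p⇒∣p∣≡p h))
  ... | inj₂ h = ℚ.≤-trans h (ℚ.0≤∣p∣ p)

  ∣∣-tri : ∀ a b → ℚ.∣ a ∣ ℚ.≤ ℚ.∣ b ∣ ℚ.+ ℚ.∣ a ℚ.- b ∣
  ∣∣-tri a b = subst (ℚ._≤ ℚ.∣ b ∣ ℚ.+ ℚ.∣ a ℚ.- b ∣)
    (cong ℚ.∣_∣ (QS.solve 2 (λ a b → b QS.:+ (a QS.:+ (QS.:- b)) QS.:= a) refl a b))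
    (ℚ.∣p+q∣≤∣p∣+∣q∣ b (a ℚ.- b))

open RationalLemmas

fromℚ : ℚ → ℝ
fromℚ q = mkℝ (λ _ → q) λ ε 0<ε → 0 , λ _ _ _ _ →
  subst (λ p → ℚ.∣ p ∣ ℚ.≤ ε) (sym (ℚ.+-inverseʳ q)) (ℚ.<⇒≤ 0<ε)

0ℝ 1ℝ : ℝ
0ℝ = fromℚ 0ℚ
1ℝ = fromℚ 1ℚ

infixl 6 _+_ _-_
infixl 7 _*_
infix  8 -_
infix  4 _≤_

_+_ : ℝ → ℝ → ℝ
x + y = mkℝ (λ n → seq x n ℚ.+ seq y n) λ ε 0<ε →
  let M , hx = cauchy x (ε ℚ.* ½) (0<* 0<ε 0<½)
      N , hy = cauchy y (ε ℚ.* ½) (0<* 0<ε 0<½)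
  in M ℕ.⊔ N , λ m n p q →
     let a = seq x m; b = seq y m; c = seq x n; d = seq y n in
     subst₂ ℚ._≤_
       (cong ℚ.∣_∣ refl) (half+half ε)
       (ℚ.≤-trans
         (subst (λ e → ℚ.∣ e ∣ ℚ.≤ ℚ.∣ a ℚ.- c ∣ ℚ.+ ℚ.∣ b ℚ.- d ∣)
           (QS.solve 4 (λ a b c d → (a QS.:+ (QS.:- c)) QS.:+ (b QS.:+ (QS.:- d))
                          QS.:= (a QS.:+ b) QS.:+ (QS.:- (c QS.:+ d))) refl a b c d)
           (ℚ.∣p+q∣≤∣p∣+∣q∣ (a ℚ.- c) (b ℚ.- d)))
         (ℚ.+-mono-≤
           (hx m n (ℕ.m⊔n≤o⇒m≤o M N p) (ℕ.m⊔n≤o⇒m≤o M N q))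
           (hy m n (ℕ.m⊔n≤o⇒n≤o M N p) (ℕ.m⊔n≤o⇒n≤o M N q))))

-_ : ℝ → ℝ
- x = mkℝ (λ n → ℚ.- seq x n) λ ε 0<ε →
  let N , h = cauchy x ε 0<ε
  in N , λ m n p q → subst (ℚ._≤ ε)
       (trans (∣∣-sym (seq x m) (seq x n)) (cong ℚ.∣_∣
         (QS.solve 2 (λ a b → b QS.:+ (QS.:- a) QS.:= (QS.:- a) QS.:+ (QS.:- (QS.:- b)))
           refl (seq x m) (seq x n))))
       (h m n p q)

_-_ : ℝ → ℝ → ℝ
x - y = x + (- y)

∣_∣ : ℝ → ℝ
∣ x ∣ = mkℝ (λ n → ℚ.∣ seq x n ∣) λ ε 0<ε →
  let N , h = cauchy x ε 0<ε
  in N , λ m n p q →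
     let a = seq x m; b = seq x n in
     ∣-∣-bound
       (ℚ.≤-trans (∣∣-tri a b) (ℚ.+-monoʳ-≤ ℚ.∣ b ∣ (h m n p q)))
       (ℚ.≤-trans (∣∣-tri b a) (ℚ.+-monoʳ-≤ ℚ.∣ a ∣ (h n m q p)))

module BoundLemmas where
  eventuallyBounded : ∀ x → ∃ λ B → 0ℚ ℚ.< B ×
    (∃ λ N → ∀ n → N ℕ.≤ n → ℚ.∣ seq x n ∣ ℚ.≤ B)
  eventuallyBounded x =
    let N , h = cauchy x 1ℚ 0<1
        a = seq x N
    in ℚ.∣ a ∣ ℚ.+ 1ℚ
     , ℚ.+-mono-≤-< (ℚ.0≤∣p∣ a) 0<1
     , N , λ n p → ℚ.≤-trans (∣∣-tri (seq x n) a)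
             (ℚ.+-monoʳ-≤ ℚ.∣ a ∣ (h n N p ℕ.≤-refl))

open BoundLemmas

_*_ : ℝ → ℝ → ℝ
x * y = mkℝ (λ n → seq x n ℚ.* seq y n) λ ε 0<ε →
  let A , 0<A , M , hA = eventuallyBounded x
      B , 0<B , N , hB = eventuallyBounded y
      C   = A ℚ.+ B
      0<C : 0ℚ ℚ.< C
      0<C = ℚ.+-mono-< 0<A 0<B
      instance
        C+ : ℚ.Positive C
        C+ = ℚ.positive 0<C
        C≢0 : ℚ.NonZero C
        C≢0 = ℚ.pos⇒nonZero C
      δ   = ε ℚ.* ½ ℚ.* 1/ C
      0<δ : 0ℚ ℚ.< δ
      0<δ = 0<* (0<* 0<ε 0<½) (ℚ.positive⁻¹ (1/ C) {{ℚ.1/pos⇒pos C}})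
      C*δ : C ℚ.* δ ≡ ε ℚ.* ½
      C*δ = trans (QS.solve 3 (λ c e i → c QS.:* (e QS.:* i) QS.:= (c QS.:* i) QS.:* e)
                    refl C (ε ℚ.* ½) (1/ C))
              (trans (cong (ℚ._* (ε ℚ.* ½)) (ℚ.*-inverseʳ C)) (ℚ.*-identityˡ (ε ℚ.* ½)))
      A≤C : A ℚ.≤ C
      A≤C = subst (ℚ._≤ C) (ℚ.+-identityʳ A) (ℚ.+-monoʳ-≤ A (ℚ.<⇒≤ 0<B))
      B≤C : B ℚ.≤ C
      B≤C = subst (ℚ._≤ C) (ℚ.+-identityˡ B) (ℚ.+-monoˡ-≤ B (ℚ.<⇒≤ 0<A))
      M′ , hx = cauchy x δ 0<δ
      N′ , hy = cauchy y δ 0<δ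
      K₁ = M ℕ.⊔ N
      K₂ = M′ ℕ.⊔ N′
  in K₁ ℕ.⊔ K₂ , λ m n p q →
     let a = seq x m; b = seq y m; c = seq x n; d = seq y n
         p₁ = ℕ.m⊔n≤o⇒m≤o K₁ K₂ p; p₂ = ℕ.m⊔n≤o⇒n≤o K₁ K₂ p
         q₁ = ℕ.m⊔n≤o⇒m≤o K₁ K₂ q; q₂ = ℕ.m⊔n≤o⇒n≤o K₁ K₂ q
         ∣a∣≤C = ℚ.≤-trans (hA m (ℕ.m⊔n≤o⇒m≤o M N p₁)) A≤C
         ∣d∣≤C = ℚ.≤-trans (hB n (ℕ.m⊔n≤o⇒n≤o M N q₁)) B≤C
         ∣b-d∣ = hy m n (ℕ.m⊔n≤o⇒n≤o M′ N′ p₂) (ℕ.m⊔n≤o⇒n≤o M′ N′ q₂)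
         ∣a-c∣ = hx m n (ℕ.m⊔n≤o⇒m≤o M′ N′ p₂) (ℕ.m⊔n≤o⇒m≤o M′ N′ q₂)
         0≤δ = ℚ.<⇒≤ 0<δ
     in ℚ.≤-trans
          (subst (λ e → ℚ.∣ e ∣ ℚ.≤ ℚ.∣ a ℚ.* (b ℚ.- d) ∣ ℚ.+ ℚ.∣ d ℚ.* (a ℚ.- c) ∣)
            (QS.solve 4 (λ a b c d →
                 a QS.:* (b QS.:+ (QS.:- d)) QS.:+ d QS.:* (a QS.:+ (QS.:- c))
                   QS.:= a QS.:* b QS.:+ (QS.:- (c QS.:* d))) refl a b c d)
            (ℚ.∣p+q∣≤∣p∣+∣q∣ (a ℚ.* (b ℚ.- d)) (d ℚ.* (a ℚ.- c))))
          (subst (ℚ.∣ a ℚ.* (b ℚ.- d) ∣ ℚ.+ ℚ.∣ d ℚ.* (a ℚ.- c) ∣ ℚ.≤_)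
            (trans (cong₂ ℚ._+_ C*δ C*δ) (half+half ε))
            (ℚ.+-mono-≤
              (subst (ℚ._≤ C ℚ.* δ) (sym (ℚ.∣p*q∣≡∣p∣*∣q∣ a (b ℚ.- d)))
                (*-mono (ℚ.0≤∣p∣ a) 0≤δ ∣a∣≤C ∣b-d∣))
              (subst (ℚ._≤ C ℚ.* δ) (sym (ℚ.∣p*q∣≡∣p∣*∣q∣ d (a ℚ.- c)))
                (*-mono (ℚ.0≤∣p∣ d) 0≤δ ∣d∣≤C ∣a-c∣))))

_≤_ : ℝ → ℝ → Set
x ≤ y = ∀ ε → 0ℚ ℚ.< ε → ∃ λ N → ∀ n → N ℕ.≤ n → seq x n ℚ.≤ seq y n ℚ.+ ε

Positive : ℝ → Set
Positive x = ∃ λ q → 0ℚ ℚ.< q × (∃ λ N → ∀ n → N ℕ.≤ n → q ℚ.≤ seq x n)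

module ReciprocalLemmas where
  0<⊔ : ∀ {q} → 0ℚ ℚ.< q → ∀ p → 0ℚ ℚ.< q ℚ.⊔ p
  0<⊔ {q} 0<q p = ℚ.<-≤-trans 0<q (ℚ.p≤p⊔q q p)

  ⊔≢0 : ∀ {q} → 0ℚ ℚ.< q → ∀ p → ℚ.NonZero (q ℚ.⊔ p)
  ⊔≢0 {q} 0<q p = ℚ.>-nonZero (0<⊔ 0<q p)

  recip-diff : ∀ {q a b} (0<q : 0ℚ ℚ.< q) → q ℚ.≤ a → q ℚ.≤ b → ∀ ε → 0ℚ ℚ.≤ ε →
    ℚ.∣ a ℚ.- b ∣ ℚ.≤ q ℚ.* q ℚ.* ε →
    ℚ.∣ (1/ (q ℚ.⊔ a)) {{⊔≢0 0<q a}} ℚ.- (1/ (q ℚ.⊔ b)) {{⊔≢0 0<q b}} ∣ ℚ.≤ ε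
  recip-diff {q} {a} {b} 0<q q≤a q≤b ε 0≤ε h =
    ℚ.*-cancelˡ-≤-pos (A ℚ.* B) {{ℚ.positive 0<AB}} (begin
      A ℚ.* B ℚ.* ℚ.∣ u ℚ.- v ∣
        ≡⟨ cong (ℚ._* ℚ.∣ u ℚ.- v ∣) (sym (ℚ.0≤p⇒∣p∣≡p (ℚ.<⇒≤ 0<AB))) ⟩
      ℚ.∣ A ℚ.* B ∣ ℚ.* ℚ.∣ u ℚ.- v ∣
        ≡⟨ sym (ℚ.∣p*q∣≡∣p∣*∣q∣ (A ℚ.* B) (u ℚ.- v)) ⟩
      ℚ.∣ A ℚ.* B ℚ.* (u ℚ.- v) ∣
        ≡⟨ cong ℚ.∣_∣ (QS.solve 4 (λ A B u v → A QS.:* B QS.:* (u QS.:+ (QS.:- v))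
             QS.:= (A QS.:* u) QS.:* B QS.:+ (QS.:- ((B QS.:* v) QS.:* A))) refl A B u v) ⟩
      ℚ.∣ (A ℚ.* u) ℚ.* B ℚ.- (B ℚ.* v) ℚ.* A ∣
        ≡⟨ cong₂ (λ s t → ℚ.∣ s ℚ.* B ℚ.- t ℚ.* A ∣) (ℚ.*-inverseʳ A) (ℚ.*-inverseʳ B) ⟩
      ℚ.∣ 1ℚ ℚ.* B ℚ.- 1ℚ ℚ.* A ∣
        ≡⟨ cong₂ (λ s t → ℚ.∣ s ℚ.- t ∣) (ℚ.*-identityˡ B) (ℚ.*-identityˡ A) ⟩
      ℚ.∣ B ℚ.- A ∣
        ≡⟨ ∣∣-sym B A ⟩
      ℚ.∣ A ℚ.- B ∣
        ≡⟨ cong₂ (λ s t → ℚ.∣ s ℚ.- t ∣) A≡a B≡b ⟩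
      ℚ.∣ a ℚ.- b ∣
        ≤⟨ h ⟩
      q ℚ.* q ℚ.* ε
        ≤⟨ ℚ.*-monoʳ-≤-nonNeg ε {{ℚ.nonNegative 0≤ε}}
             (*-mono 0≤q (ℚ.<⇒≤ (0<⊔ 0<q b)) (ℚ.p≤p⊔q q a) (ℚ.p≤p⊔q q b)) ⟩
      A ℚ.* B ℚ.* ε ∎)
    where
    open ℚ.≤-Reasoning
    A = q ℚ.⊔ a
    B = q ℚ.⊔ b
    instance
      A≢0 : ℚ.NonZero A
      A≢0 = ⊔≢0 0<q a
      B≢0 : ℚ.NonZero B
      B≢0 = ⊔≢0 0<q b
    u = 1/ A
    v = 1/ B
    0≤q = ℚ.<⇒≤ 0<q
    0<AB = 0<* (0<⊔ 0<q a) (0<⊔ 0<q b)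
    A≡a = ℚ.p≤q⇒p⊔q≡q q≤a
    B≡b = ℚ.p≤q⇒p⊔q≡q q≤b

open ReciprocalLemmas

-- Truncating below at the positive lower bound q makes every term
-- invertible and changes only finitely many of them.
inv : (x : ℝ) → Positive x → ℝ
inv x (q , 0<q , M , h) =
  mkℝ (λ n → (1/ (q ℚ.⊔ seq x n)) {{⊔≢0 0<q (seq x n)}}) λ ε 0<ε →
    let N , k = cauchy x (q ℚ.* q ℚ.* ε) (0<* (0<* 0<q 0<q) 0<ε)
    in M ℕ.⊔ N , λ m n a b →
       recip-diff 0<q (h m (ℕ.m⊔n≤o⇒m≤o M N a)) (h n (ℕ.m⊔n≤o⇒m≤o M N b)) ε (ℚ.<⇒≤ 0<ε)
         (k m n (ℕ.m⊔n≤o⇒n≤o M N a) (ℕ.m⊔n≤o⇒n≤o M N b))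

infix 4 _⟶_

_⟶_ : (ℕ → ℝ) → ℝ → Set
a ⟶ L = ∀ ε → 0ℚ ℚ.< ε → ∃ λ N → ∀ n → N ℕ.≤ n → ∣ a n - L ∣ ≤ fromℚ ε

sumℚ : (ℕ → ℚ) → ℕ → ℚ
sumℚ f zero    = 0ℚ
sumℚ f (suc n) = sumℚ f n ℚ.+ f n

if-holds : ∀ {A : Set} → Dec A → (.A → ℝ) → ℝ
if-holds (yes a) f = f a
if-holds (no _)  f = 0ℝ

∑ : {P : Pred ℕ 0ℓ} → Decidable P → (∀ n → .(P n) → ℝ) → ℕ → ℝ
∑ P? f zero    = 0ℝ
∑ P? f (suc N) = ∑ P? f N + if-holds (P? N) (f N)

SumsTo : {P : Pred ℕ 0ℓ} → Decidable P → (∀ n → .(P n) → ℝ) → ℝ → Set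
SumsTo P? f L = ∑ P? f ⟶ L

module SeriesLemmas where
  sum-mono : ∀ {f g : ℕ → ℚ} → (∀ n → f n ℚ.≤ g n) → ∀ N → sumℚ f N ℚ.≤ sumℚ g N
  sum-mono f≤g zero    = ℚ.≤-refl
  sum-mono f≤g (suc N) = ℚ.+-mono-≤ (sum-mono f≤g N) (f≤g N)

  sum-nonneg : ∀ {f : ℕ → ℚ} → (∀ n → 0ℚ ℚ.≤ f n) → ∀ N → 0ℚ ℚ.≤ sumℚ f N
  sum-nonneg 0≤f zero    = ℚ.≤-refl
  sum-nonneg 0≤f (suc N) = ℚ.+-mono-≤ (sum-nonneg 0≤f N) (0≤f N)

  sum-* : ∀ c f N → sumℚ (λ n → c ℚ.* f n) N ≡ c ℚ.* sumℚ f N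
  sum-* c f zero    = sym (ℚ.*-zeroʳ c)
  sum-* c f (suc N) = trans (cong (ℚ._+ c ℚ.* f N) (sum-* c f N))
                        (sym (ℚ.*-distribˡ-+ c (sumℚ f N) (f N)))

  sum-incr : ∀ {f : ℕ → ℚ} → (∀ n → 0ℚ ℚ.≤ f n) → ∀ {M N} → M ℕ.≤′ N → sumℚ f M ℚ.≤ sumℚ f N
  sum-incr 0≤f ℕ.≤′-refl = ℚ.≤-refl
  sum-incr {f} 0≤f {M} {suc N} (ℕ.≤′-step p) = ℚ.≤-trans (sum-incr 0≤f p)
    (subst (ℚ._≤ sumℚ f (suc N)) (ℚ.+-identityʳ (sumℚ f N))
      (ℚ.+-monoʳ-≤ (sumℚ f N) (0≤f N)))

  telescope : ∀ {f b : ℕ → ℚ} → (∀ n → f n ℚ.+ b (suc n) ℚ.≤ b n) → ∀ {M N} → M ℕ.≤′ N →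
              sumℚ f N ℚ.+ b N ℚ.≤ sumℚ f M ℚ.+ b M
  telescope h ℕ.≤′-refl = ℚ.≤-refl
  telescope {f} {b} h {M} {suc N} (ℕ.≤′-step p) = ℚ.≤-trans
    (subst (ℚ._≤ sumℚ f N ℚ.+ b N) (sym (ℚ.+-assoc (sumℚ f N) (f N) (b (suc N))))
      (ℚ.+-monoʳ-≤ (sumℚ f N) (h N)))
    (telescope {f} {b} h p)

  -- If 0 ≤ f n ≤ b n - b (n + 1) with b ≥ 0 tending to 0, then ∑ f converges.
  telescoping-cauchy : ∀ {f b : ℕ → ℚ} → (∀ n → 0ℚ ℚ.≤ f n) → (∀ n → 0ℚ ℚ.≤ b n) →
    (∀ n → f n ℚ.+ b (suc n) ℚ.≤ b n) →
    (∀ ε → 0ℚ ℚ.< ε → ∃ λ N → b N ℚ.≤ ε) → IsCauchy (sumℚ f)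
  telescoping-cauchy {f} {b} 0≤f 0≤b h b→0 ε 0<ε =
    let N , bN≤ε = b→0 ε 0<ε
        s = sumℚ f
        lower : ∀ n → N ℕ.≤ n → s N ℚ.≤ s n
        lower n p = sum-incr {f} 0≤f (ℕ.≤⇒≤′ p)
        upper : ∀ n → N ℕ.≤ n → s n ℚ.≤ s N ℚ.+ ε
        upper n p = ℚ.≤-trans
          (subst (ℚ._≤ s n ℚ.+ b n) (ℚ.+-identityʳ (s n)) (ℚ.+-monoʳ-≤ (s n) (0≤b n)))
          (ℚ.≤-trans (telescope {f} {b} h (ℕ.≤⇒≤′ p)) (ℚ.+-monoʳ-≤ (s N) bN≤ε))
    in N , λ m n p q → ∣-∣-bound
         (ℚ.≤-trans (upper m p) (ℚ.+-monoˡ-≤ ε (lower n q)))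
         (ℚ.≤-trans (upper n q) (ℚ.+-monoˡ-≤ ε (lower m p)))

  recip : (n : ℕ) .{{_ : ℕ.NonZero n}} → ℚ
  recip n = + 1 ℚ./ n

  toℚᵘ-recip : ∀ n → toℚᵘ (recip (suc n)) ℚᵘ.≃ mkℚᵘ (+ 1) n
  toℚᵘ-recip n = ℚ.toℚᵘ-fromℚᵘ (mkℚᵘ (+ 1) n)

  recip-nonneg : ∀ n .{{_ : ℕ.NonZero n}} → 0ℚ ℚ.≤ recip n
  recip-nonneg n = ℚ.nonNegative⁻¹ (recip n) {{ℚ.normalize-nonNeg 1 n}}

  recip-anti : ∀ {m n} .{{_ : ℕ.NonZero m}} .{{_ : ℕ.NonZero n}} →
               m ℕ.≤ n → recip n ℚ.≤ recip m
  recip-anti {suc m} {suc n} m≤n = ℚ.toℚᵘ-cancel-≤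
    (ℚᵘ.≤-respˡ-≃ (ℚᵘ.≃-sym (toℚᵘ-recip n)) (ℚᵘ.≤-respʳ-≃ (ℚᵘ.≃-sym (toℚᵘ-recip m))
      (ℚᵘ.*≤* (subst₂ ℤ._≤_ (sym (ℤ.*-identityˡ (+ suc m))) (sym (ℤ.*-identityˡ (+ suc n)))
        (ℤ.+≤+ m≤n)))))

  c : ℕ → ℚ
  c n = recip (suc n)

  c-nonneg : ∀ n → 0ℚ ℚ.≤ c n
  c-nonneg n = recip-nonneg (suc n)

  recip-* : ∀ m n .{{_ : ℕ.NonZero m}} .{{_ : ℕ.NonZero n}} .{{_ : ℕ.NonZero (m ℕ.* n)}} →
            recip (m ℕ.* n) ≡ recip m ℚ.* recip n
  recip-* (suc m) (suc n) = ℚ.toℚᵘ-injective (begin-equality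
    toℚᵘ (recip (suc m ℕ.* suc n))
      ≃⟨ toℚᵘ-recip (n ℕ.+ m ℕ.* suc n) ⟩
    mkℚᵘ (+ 1) m ℚᵘ.* mkℚᵘ (+ 1) n
      ≃⟨ ℚᵘ.*-cong (ℚᵘ.≃-sym (toℚᵘ-recip m)) (ℚᵘ.≃-sym (toℚᵘ-recip n)) ⟩
    toℚᵘ (c m) ℚᵘ.* toℚᵘ (c n)
      ≃⟨ ℚᵘ.≃-sym (ℚ.toℚᵘ-homo-* (c m) (c n)) ⟩
    toℚᵘ (c m ℚ.* c n) ∎)
    where open ℚᵘ.≤-Reasoning

  c-step : ∀ n → c n ≡ c (suc n) ℚ.+ c n ℚ.* c (suc n)
  c-step n = ℚ.toℚᵘ-injective (begin-equality
    toℚᵘ (c n)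
      ≃⟨ toℚᵘ-recip n ⟩
    x
      ≃⟨ ℚᵘ.*≡* (ZS.solve 1 (λ N → let one = ZS.con (+ 1); N′ = one ZS.:+ N in
             one ZS.:* (N′ ZS.:* (N ZS.:* N′))
               ZS.:= (one ZS.:* (N ZS.:* N′) ZS.:+ (one ZS.:* one) ZS.:* N′) ZS.:* N)
           refl (+ suc n)) ⟩
    y ℚᵘ.+ x ℚᵘ.* y
      ≃⟨ ℚᵘ.+-cong (ℚᵘ.≃-sym (toℚᵘ-recip (suc n)))
           (ℚᵘ.*-cong (ℚᵘ.≃-sym (toℚᵘ-recip n)) (ℚᵘ.≃-sym (toℚᵘ-recip (suc n)))) ⟩
    toℚᵘ (c (suc n)) ℚᵘ.+ toℚᵘ (c n) ℚᵘ.* toℚᵘ (c (suc n))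
      ≃⟨ ℚᵘ.+-congʳ (toℚᵘ (c (suc n))) (ℚᵘ.≃-sym (ℚ.toℚᵘ-homo-* (c n) (c (suc n)))) ⟩
    toℚᵘ (c (suc n)) ℚᵘ.+ toℚᵘ (c n ℚ.* c (suc n))
      ≃⟨ ℚᵘ.≃-sym (ℚ.toℚᵘ-homo-+ (c (suc n)) (c n ℚ.* c (suc n))) ⟩
    toℚᵘ (c (suc n) ℚ.+ c n ℚ.* c (suc n)) ∎)
    where
    open ℚᵘ.≤-Reasoning
    x = mkℚᵘ (+ 1) n
    y = mkℚᵘ (+ 1) (suc n)

  2ℚ : ℚ
  2ℚ = 1ℚ ℚ.+ 1ℚ

  0≤2 : 0ℚ ℚ.≤ 2ℚ
  0≤2 = ℚ.nonNegative⁻¹ 2ℚ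

  c≤1 : ∀ n → c n ℚ.≤ 1ℚ
  c≤1 n = recip-anti {1} {suc n} (s≤s z≤n)

  c≤2c : ∀ n → c n ℚ.≤ 2ℚ ℚ.* c (suc n)
  c≤2c n = begin
    c n                          ≡⟨ c-step n ⟩
    c (suc n) ℚ.+ c n ℚ.* c (suc n)
      ≤⟨ ℚ.+-monoʳ-≤ (c (suc n)) (ℚ.*-monoʳ-≤-nonNeg (c (suc n))
           {{ℚ.nonNegative (c-nonneg (suc n))}} (c≤1 n)) ⟩
    c (suc n) ℚ.+ 1ℚ ℚ.* c (suc n)
      ≡⟨ QS.solve 1 (λ x → x QS.:+ QS.con 1ℚ QS.:* x QS.:= QS.con 2ℚ QS.:* x) refl (c (suc n)) ⟩
    2ℚ ℚ.* c (suc n) ∎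
    where open ℚ.≤-Reasoning

  c²≤ : ∀ n → c n ℚ.* c n ℚ.≤ 2ℚ ℚ.* (c n ℚ.* c (suc n))
  c²≤ n = subst (c n ℚ.* c n ℚ.≤_)
    (QS.solve 2 (λ x y → x QS.:* (QS.con 2ℚ QS.:* y) QS.:= QS.con 2ℚ QS.:* (x QS.:* y))
      refl (c n) (c (suc n)))
    (ℚ.*-monoˡ-≤-nonNeg (c n) {{ℚ.nonNegative (c-nonneg n)}} (c≤2c n))

  archimedean : ∀ ε → 0ℚ ℚ.< ε → ∃ λ n → c n ℚ.≤ ε
  archimedean (mkℚ (+ 0)  d _) (ℚ.*<* (ℤ.+<+ ()))
  archimedean (mkℚ ℤ.-[1+ _ ] d _) (ℚ.*<* ())
  archimedean (mkℚ +[1+ p ] d _) _ = d , ℚ.toℚᵘ-cancel-≤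
    (ℚᵘ.≤-respˡ-≃ (ℚᵘ.≃-sym (toℚᵘ-recip d))
      (ℚᵘ.*≤* (ℤ.*-monoʳ-≤-nonNeg (+ suc d) {+ 1} {+ suc p} (ℤ.+≤+ (s≤s z≤n)))))

  scaled-archimedean : ∀ m ε → 0ℚ ℚ.< ε → ∃ λ n →
    (+ suc m ℚ./ 1) ℚ.* c n ℚ.≤ ε
  scaled-archimedean m ε 0<ε = n , (begin
      k ℚ.* c n              ≤⟨ ℚ.*-monoˡ-≤-nonNeg k {{ℚ.pos⇒nonNeg k}} h ⟩
      k ℚ.* (1/ k ℚ.* ε)     ≡⟨ sym (ℚ.*-assoc k (1/ k) ε) ⟩
      k ℚ.* 1/ k ℚ.* ε       ≡⟨ cong (ℚ._* ε) (ℚ.*-inverseʳ k) ⟩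
      1ℚ ℚ.* ε               ≡⟨ ℚ.*-identityˡ ε ⟩
      ε ∎)
    where
    open ℚ.≤-Reasoning
    k = + suc m ℚ./ 1
    instance
      k+ : ℚ.Positive k
      k+ = ℚ.normalize-pos (suc m) 1
      k≢0 : ℚ.NonZero k
      k≢0 = ℚ.pos⇒nonZero k
    w = archimedean (1/ k ℚ.* ε) (0<* (ℚ.positive⁻¹ (1/ k) {{ℚ.1/pos⇒pos k}}) 0<ε)
    n = proj₁ w
    h = proj₂ w

open SeriesLemmas

-- Indices start at 0: the index m stands for the integer m + 1 in ∑ 1/mᵏ, and
-- likewise m and n in ∑ 1/(mʳnˢ), so that m > n > 0 becomes n < m.

ζ-term : ℕ → ℕ → ℚ
ζ-term k m = (+ 1 ℚ./ (suc m ℕ.^ k)) {{ℕ.m^n≢0 (suc m) k}}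

^*^-nonZero : ∀ m r n s → ℕ.NonZero (suc m ℕ.^ r ℕ.* suc n ℕ.^ s)
^*^-nonZero m r n s =
  ℕ.m*n≢0 (suc m ℕ.^ r) (suc n ℕ.^ s) {{ℕ.m^n≢0 (suc m) r}} {{ℕ.m^n≢0 (suc n) s}}

ζ₂-summand : (r s m n : ℕ) → ℚ
ζ₂-summand r s m n =
  (+ 1 ℚ./ (suc m ℕ.^ r ℕ.* suc n ℕ.^ s)) {{^*^-nonZero m r n s}}

ζ₂-term : (r s m : ℕ) → ℚ
ζ₂-term r s m = sumℚ (ζ₂-summand r s m) m

module ZetaLemmas where
  ^≥1 : ∀ {k} → 1 ℕ.≤ k → ∀ m → suc m ℕ.≤ suc m ℕ.^ k
  ^≥1 {k} h m = subst (ℕ._≤ suc m ℕ.^ k) (ℕ.^-identityʳ (suc m)) (ℕ.^-monoʳ-≤ (suc m) h)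

  ^≥2 : ∀ {k} → 2 ℕ.≤ k → ∀ m → suc m ℕ.* suc m ℕ.≤ suc m ℕ.^ k
  ^≥2 {k} h m = subst (ℕ._≤ suc m ℕ.^ k) (cong (suc m ℕ.*_) (ℕ.^-identityʳ (suc m)))
                  (ℕ.^-monoʳ-≤ (suc m) h)

  ζ-term-nonneg : ∀ k m → 0ℚ ℚ.≤ ζ-term k m
  ζ-term-nonneg k m = recip-nonneg (suc m ℕ.^ k) {{ℕ.m^n≢0 (suc m) k}}

  ζ-term-≤ : ∀ {k} → 2 ℕ.≤ k → ∀ m → ζ-term k m ℚ.≤ c m ℚ.* c m
  ζ-term-≤ {k} h m = subst (ζ-term k m ℚ.≤_) (recip-* (suc m) (suc m))
    (recip-anti {suc m ℕ.* suc m} {suc m ℕ.^ k} {{_}} {{ℕ.m^n≢0 (suc m) k}} (^≥2 h m))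

  ζ-cauchy : ∀ {k} → 2 ℕ.≤ k → IsCauchy (sumℚ (ζ-term k))
  ζ-cauchy {k} h = telescoping-cauchy {ζ-term k} {λ n → 2ℚ ℚ.* c n} (ζ-term-nonneg k)
    (λ n → 0≤* 0≤2 (c-nonneg n))
    (λ n → begin
      ζ-term k n ℚ.+ 2ℚ ℚ.* c (suc n)
        ≤⟨ ℚ.+-monoˡ-≤ (2ℚ ℚ.* c (suc n)) (ℚ.≤-trans (ζ-term-≤ h n) (c²≤ n)) ⟩
      2ℚ ℚ.* (c n ℚ.* c (suc n)) ℚ.+ 2ℚ ℚ.* c (suc n)
        ≡⟨ QS.solve 2 (λ x y → QS.con 2ℚ QS.:* (x QS.:* y) QS.:+ QS.con 2ℚ QS.:* y
             QS.:= QS.con 2ℚ QS.:* (y QS.:+ x QS.:* y)) refl (c n) (c (suc n)) ⟩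
      2ℚ ℚ.* (c (suc n) ℚ.+ c n ℚ.* c (suc n))
        ≡⟨ cong (2ℚ ℚ.*_) (sym (c-step n)) ⟩
      2ℚ ℚ.* c n ∎)
    (scaled-archimedean 1)
    where open ℚ.≤-Reasoning

  H : ℕ → ℚ
  H = sumℚ c

  H-nonneg : ∀ n → 0ℚ ℚ.≤ H n
  H-nonneg = sum-nonneg c-nonneg

  fromℕ : ℕ → ℚ
  fromℕ zero    = 0ℚ
  fromℕ (suc n) = fromℕ n ℚ.+ 1ℚ

  fromℕ-nonneg : ∀ n → 0ℚ ℚ.≤ fromℕ n
  fromℕ-nonneg zero    = ℚ.≤-refl
  fromℕ-nonneg (suc n) = ℚ.+-mono-≤ (fromℕ-nonneg n) 0≤1

  fromℕ-mono : ∀ {m n} → m ℕ.≤ n → fromℕ m ℚ.≤ fromℕ n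
  fromℕ-mono {n = n} z≤n = fromℕ-nonneg n
  fromℕ-mono (s≤s p) = ℚ.+-monoˡ-≤ 1ℚ (fromℕ-mono p)

  H≤N : ∀ n → H n ℚ.≤ fromℕ n
  H≤N zero    = ℚ.≤-refl
  H≤N (suc n) = ℚ.+-mono-≤ (H≤N n) (c≤1 n)

  c*suc : ∀ n → fromℕ (suc n) ℚ.* c n ≡ 1ℚ
  c*suc zero    = refl
  c*suc (suc n) = begin
    (N ℚ.+ 1ℚ) ℚ.* y
      ≡⟨ QS.solve 2 (λ N y → (N QS.:+ QS.con 1ℚ) QS.:* y QS.:= N QS.:* y QS.:+ y) refl N y ⟩
    N ℚ.* y ℚ.+ y
      ≡⟨ cong (N ℚ.* y ℚ.+_) (trans (sym (ℚ.*-identityˡ y)) (cong (ℚ._* y) (sym (c*suc n)))) ⟩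
    N ℚ.* y ℚ.+ N ℚ.* x ℚ.* y
      ≡⟨ QS.solve 3 (λ N x y → N QS.:* y QS.:+ N QS.:* x QS.:* y
           QS.:= N QS.:* (y QS.:+ x QS.:* y)) refl N x y ⟩
    N ℚ.* (y ℚ.+ x ℚ.* y)
      ≡⟨ cong (N ℚ.*_) (sym (c-step n)) ⟩
    N ℚ.* x
      ≡⟨ c*suc n ⟩
    1ℚ ∎
    where
    open ≡-Reasoning
    N = fromℕ (suc n)
    x = c n
    y = c (suc n)

  -- The first K terms are at most 1 and the later ones at most 1/(K + 1).
  H-bound : ∀ K N → H N ℚ.≤ fromℕ K ℚ.+ fromℕ N ℚ.* c K
  H-bound K zero = subst (0ℚ ℚ.≤_)
    (sym (trans (cong (fromℕ K ℚ.+_) (ℚ.*-zeroˡ (c K))) (ℚ.+-identityʳ (fromℕ K))))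
    (fromℕ-nonneg K)
  H-bound K (suc N) with K ℕ.≤? N
  ... | yes K≤N = subst (H (suc N) ℚ.≤_)
          (QS.solve 3 (λ K N d → (K QS.:+ N QS.:* d) QS.:+ d
             QS.:= K QS.:+ (N QS.:+ QS.con 1ℚ) QS.:* d) refl (fromℕ K) (fromℕ N) (c K))
          (ℚ.+-mono-≤ (H-bound K N) (recip-anti {suc K} {suc N} (s≤s K≤N)))
  ... | no K≰N = ℚ.≤-trans (H≤N (suc N)) (ℚ.≤-trans (fromℕ-mono (ℕ.≰⇒> K≰N))
          (subst (ℚ._≤ fromℕ K ℚ.+ fromℕ (suc N) ℚ.* c K) (ℚ.+-identityʳ (fromℕ K))
            (ℚ.+-monoʳ-≤ (fromℕ K) (0≤* (fromℕ-nonneg (suc N)) (c-nonneg K)))))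

  tail : ℕ → ℚ
  tail n = 2ℚ ℚ.* (c n ℚ.* (H n ℚ.+ 1ℚ))

  tail→0 : ∀ ε → 0ℚ ℚ.< ε → ∃ λ N → tail N ℚ.≤ ε
  tail→0 ε 0<ε = N , ℚ.≤-trans (ℚ.*-monoˡ-≤-nonNeg 2ℚ (begin
      c N ℚ.* (H N ℚ.+ 1ℚ)
        ≤⟨ ℚ.*-monoˡ-≤-nonNeg (c N) {{ℚ.nonNegative (c-nonneg N)}}
             (ℚ.+-monoˡ-≤ 1ℚ (H-bound K N)) ⟩
      c N ℚ.* (fromℕ K ℚ.+ fromℕ N ℚ.* c K ℚ.+ 1ℚ)
        ≤⟨ ℚ.*-monoˡ-≤-nonNeg (c N) {{ℚ.nonNegative (c-nonneg N)}}
             (ℚ.+-monoˡ-≤ 1ℚ (ℚ.+-monoʳ-≤ (fromℕ K)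
               (ℚ.*-monoʳ-≤-nonNeg (c K) {{ℚ.nonNegative (c-nonneg K)}}
                 (fromℕ-mono (ℕ.n≤1+n N))))) ⟩
      c N ℚ.* (fromℕ K ℚ.+ fromℕ (suc N) ℚ.* c K ℚ.+ 1ℚ)
        ≡⟨ QS.solve 4 (λ x K M d → x QS.:* (K QS.:+ M QS.:* d QS.:+ QS.con 1ℚ)
             QS.:= x QS.:* (K QS.:+ QS.con 1ℚ) QS.:+ (M QS.:* x) QS.:* d)
             refl (c N) (fromℕ K) (fromℕ (suc N)) (c K) ⟩
      c N ℚ.* fromℕ (suc K) ℚ.+ (fromℕ (suc N) ℚ.* c N) ℚ.* c K
        ≡⟨ cong₂ (λ u v → u ℚ.* fromℕ (suc K) ℚ.+ v ℚ.* c K)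
             (recip-* (suc K) (suc K)) (c*suc N) ⟩
      c K ℚ.* c K ℚ.* fromℕ (suc K) ℚ.+ 1ℚ ℚ.* c K
        ≡⟨ QS.solve 2 (λ d M → d QS.:* d QS.:* M QS.:+ QS.con 1ℚ QS.:* d
             QS.:= (M QS.:* d) QS.:* d QS.:+ QS.con 1ℚ QS.:* d) refl (c K) (fromℕ (suc K)) ⟩
      (fromℕ (suc K) ℚ.* c K) ℚ.* c K ℚ.+ 1ℚ ℚ.* c K
        ≡⟨ cong (λ u → u ℚ.* c K ℚ.+ 1ℚ ℚ.* c K) (c*suc K) ⟩
      1ℚ ℚ.* c K ℚ.+ 1ℚ ℚ.* c K ∎))
    (subst (ℚ._≤ ε) (QS.solve 1 (λ d → QS.con (+ 4 ℚ./ 1) QS.:* d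
        QS.:= QS.con 2ℚ QS.:* (QS.con 1ℚ QS.:* d QS.:+ QS.con 1ℚ QS.:* d)) refl (c K))
      (proj₂ w))
    where
    open ℚ.≤-Reasoning
    w = scaled-archimedean 3 ε 0<ε
    K = proj₁ w
    N = K ℕ.+ K ℕ.* suc K

  ζ₂-term-nonneg : ∀ r s m → 0ℚ ℚ.≤ ζ₂-term r s m
  ζ₂-term-nonneg r s m =
    sum-nonneg (λ n → recip-nonneg (suc m ℕ.^ r ℕ.* suc n ℕ.^ s) {{^*^-nonZero m r n s}}) m

  ζ₂-term-≤ : ∀ {r s} → 2 ℕ.≤ r → 1 ℕ.≤ s → ∀ m → ζ₂-term r s m ℚ.≤ c m ℚ.* c m ℚ.* H m
  ζ₂-term-≤ {r} {s} hr hs m = subst (ζ₂-term r s m ℚ.≤_) (sum-* (c m ℚ.* c m) c m)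
    (sum-mono (λ n → subst (ζ₂-summand r s m n ℚ.≤_)
      (trans (recip-* (suc m ℕ.* suc m) (suc n)) (cong (ℚ._* c n) (recip-* (suc m) (suc m))))
      (recip-anti {suc m ℕ.* suc m ℕ.* suc n} {suc m ℕ.^ r ℕ.* suc n ℕ.^ s}
        {{_}} {{^*^-nonZero m r n s}}
        (ℕ.*-mono-≤ (^≥2 hr m) (^≥1 hs n)))) m)

  ζ₂-cauchy : ∀ {r s} → 2 ℕ.≤ r → 1 ℕ.≤ s → IsCauchy (sumℚ (ζ₂-term r s))
  ζ₂-cauchy {r} {s} hr hs = telescoping-cauchy {ζ₂-term r s} {tail} (ζ₂-term-nonneg r s)
    (λ n → 0≤* 0≤2 (0≤* (c-nonneg n) (ℚ.+-mono-≤ (H-nonneg n) 0≤1)))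
    (λ n → let x = c n; y = c (suc n); h = H n in begin
      ζ₂-term r s n ℚ.+ tail (suc n)
        ≤⟨ ℚ.+-monoˡ-≤ (tail (suc n)) (ℚ.≤-trans (ζ₂-term-≤ hr hs n)
             (ℚ.*-monoʳ-≤-nonNeg h {{ℚ.nonNegative (H-nonneg n)}} (c²≤ n))) ⟩
      2ℚ ℚ.* (x ℚ.* y) ℚ.* h ℚ.+ 2ℚ ℚ.* (y ℚ.* (h ℚ.+ x ℚ.+ 1ℚ))
        ≡⟨ QS.solve 3 (λ x y h → QS.con 2ℚ QS.:* (x QS.:* y) QS.:* h
               QS.:+ QS.con 2ℚ QS.:* (y QS.:* (h QS.:+ x QS.:+ QS.con 1ℚ))
             QS.:= QS.con 2ℚ QS.:* ((y QS.:+ x QS.:* y) QS.:* (h QS.:+ QS.con 1ℚ)))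
             refl x y h ⟩
      2ℚ ℚ.* ((y ℚ.+ x ℚ.* y) ℚ.* (h ℚ.+ 1ℚ))
        ≡⟨ cong (λ u → 2ℚ ℚ.* (u ℚ.* (h ℚ.+ 1ℚ))) (sym (c-step n)) ⟩
      tail n ∎)
    tail→0
    where open ℚ.≤-Reasoning

open ZetaLemmas

ζ : (k : ℕ) → .(2 ℕ.≤ k) → ℝ
ζ k 2≤k = mkℝ (sumℚ (ζ-term k)) (ζ-cauchy (recompute (2 ℕ.≤? k) 2≤k))

-- The double series has positive terms, so summing it over the triangles
-- N ≥ m > n > 0 gives its value.
ζ₂ : (r s : ℕ) → .(2 ℕ.≤ r) → .(1 ℕ.≤ s) → ℝ
ζ₂ r s 2≤r 1≤s = mkℝ (sumℚ (ζ₂-term r s))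
  (ζ₂-cauchy (recompute (2 ℕ.≤? r) 2≤r) (recompute (1 ℕ.≤? s) 1≤s))

ζ-positive : ∀ k → .(2≤k : 2 ℕ.≤ k) → Positive (ζ k 2≤k)
ζ-positive k _ = 1ℚ , 0<1 , 1 , λ n 1≤n → ℚ.≤-trans
  (recip-anti {1 ℕ.^ k} {1} {{ℕ.m^n≢0 1 k}} (ℕ.≤-reflexive (ℕ.^-zeroˡ k)))
  (ℚ.≤-trans (ℚ.≤-reflexive (sym (ℚ.+-identityˡ (ζ-term k 0))))
    (sum-incr {ζ-term k} (ζ-term-nonneg k) (ℕ.≤⇒≤′ 1≤n)))

infix 4 _≡_[mod_]

_≡_[mod_] : ℕ → ℕ → ℕ → Set
a ≡ b [mod d ] = d ∣ ℕ.∣ a - b ∣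

InRange : (d i k : ℕ) → Pred ℕ 0ℓ
InRange d i k r = 2 ℕ.≤ r × r ℕ.< k × r ≡ i [mod d ]

inRange? : ∀ d i k → Decidable (InRange d i k)
inRange? d i k r = 2 ℕ.≤? r ×-dec r ℕ.<? k ×-dec d ∣? ℕ.∣ r - i ∣

AtLeast2 : (d i : ℕ) → Pred ℕ 0ℓ
AtLeast2 d i j = 2 ℕ.≤ j × j ≡ i [mod d ]

atLeast2? : ∀ d i → Decidable (AtLeast2 d i)
atLeast2? d i j = 2 ℕ.≤? j ×-dec d ∣? ℕ.∣ j - i ∣

doubleZetaSum : (d i k : ℕ) → ℝ
doubleZetaSum d i k =
  ∑ (inRange? d i k)
    (λ r p → ζ₂ r (k ℕ.∸ r) (proj₁ p) (ℕ.m<n⇒0<n∸m (proj₁ (proj₂ p))))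
    k

normalisedSum : (d i k : ℕ) → .(2 ℕ.≤ k) → ℝ
normalisedSum d i k 2≤k = inv (ζ k 2≤k) (ζ-positive k 2≤k) * doubleZetaSum d i k

{-# OPTIONS --safe #-}

-- In ζ(r, s) with r + s = k the terms with n = 1 add up to ζ(r) - 1. In the
-- others m, n ≥ 2, so they are at most 2^(3 - k) times those of ζ(2, 1), and the
-- remaining part of the sum over r is at most k 2^(3 - k) ζ(2, 1), which tends
-- to 0. Similarly 0 ≤ ζ(k) - 1 ≤ 2^(2 - k) ζ(2), so ζ(k) tends to 1 and
-- ∑ (ζ(j) - 1) converges.

module Submission where

open import Defs
open import Data.Nat.Base as ℕ using (ℕ; z≤n; s≤s)
open import Data.Product.Base using (∃; _×_; _,_; proj₁)

open import Data.Empty using (⊥-elim)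
open import Data.Integer.Base using (+_)
open import Data.Nat.Base using (zero; suc)
import Data.Nat.Properties as ℕ
open import Data.Product.Base using (proj₂)
open import Data.Rational.Base as ℚ using (ℚ; 0ℚ; 1ℚ; ½; 1/_)
import Data.Rational.Properties as ℚ
import Data.Rational.Solver as ℚSolver
open import Relation.Binary.PropositionalEquality
open import Relation.Nullary.Decidable using (Dec; yes; no)
open import Relation.Unary using (Pred; Decidable)
open import Level using (0ℓ)

open RationalLemmas
open BoundLemmas
open ReciprocalLemmas
open SeriesLemmas
open ZetaLemmas

private
  module QS = ℚSolver.+-*-Solver

-- Rational inequalities

∣-∣-triangle : ∀ a b c {e f} → ℚ.∣ a ℚ.- b ∣ ℚ.≤ e → ℚ.∣ b ℚ.- c ∣ ℚ.≤ f →
               ℚ.∣ a ℚ.- c ∣ ℚ.≤ e ℚ.+ f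
∣-∣-triangle a b c p q = ℚ.≤-trans
  (subst (λ x → ℚ.∣ x ∣ ℚ.≤ ℚ.∣ a ℚ.- b ∣ ℚ.+ ℚ.∣ b ℚ.- c ∣)
    (QS.solve 3 (λ a b c → (a QS.:+ (QS.:- b)) QS.:+ (b QS.:+ (QS.:- c))
       QS.:= a QS.:+ (QS.:- c)) refl a b c)
    (ℚ.∣p+q∣≤∣p∣+∣q∣ (a ℚ.- b) (b ℚ.- c)))
  (ℚ.+-mono-≤ p q)

∣-∣-swap : ∀ a b {e} → ℚ.∣ a ℚ.- b ∣ ℚ.≤ e → ℚ.∣ b ℚ.- a ∣ ℚ.≤ e
∣-∣-swap a b {e} = subst (ℚ._≤ e) (∣∣-sym a b)

∣p-p∣≤ : ∀ p {e} → 0ℚ ℚ.≤ e → ℚ.∣ p ℚ.- p ∣ ℚ.≤ e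
∣p-p∣≤ p {e} = subst (λ q → ℚ.∣ q ∣ ℚ.≤ e) (sym (ℚ.+-inverseʳ p))

p≤p+q : ∀ p {q} → 0ℚ ℚ.≤ q → p ℚ.≤ p ℚ.+ q
p≤p+q p {q} 0≤q = subst (ℚ._≤ p ℚ.+ q) (ℚ.+-identityʳ p) (ℚ.+-monoʳ-≤ p 0≤q)

∃-scaled : ∀ C → 0ℚ ℚ.< C → ∀ ε → 0ℚ ℚ.< ε → ∃ λ δ → 0ℚ ℚ.< δ × C ℚ.* δ ≡ ε
∃-scaled C 0<C ε 0<ε = 1/ C ℚ.* ε
  , 0<* (ℚ.positive⁻¹ (1/ C) {{ℚ.1/pos⇒pos C}}) 0<ε
  , trans (sym (ℚ.*-assoc C (1/ C) ε))
      (trans (cong (ℚ._* ε) (ℚ.*-inverseʳ C)) (ℚ.*-identityˡ ε))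
  where
  instance
    C+ : ℚ.Positive C
    C+ = ℚ.positive 0<C
    C≢0 : ℚ.NonZero C
    C≢0 = ℚ.pos⇒nonZero C

-- The exponential errors below are only ever compared with multiples of 1/(n + 1), so the
-- Archimedean property and the monotonicity of `c` yield explicit thresholds.
c-dominated⇒vanishing : ∀ {b : ℕ → ℚ} {K} → 0ℚ ℚ.< K → (∀ n → b n ℚ.≤ K ℚ.* c n) →
  ∀ ε → 0ℚ ℚ.< ε → ∃ λ M → ∀ n → M ℕ.≤ n → b n ℚ.≤ ε
c-dominated⇒vanishing {b} {K} 0<K b≤Kc ε 0<ε =
  let δ , 0<δ , Kδ≡ε = ∃-scaled K 0<K ε 0<ε
      M , cM≤δ = archimedean δ 0<δ
  in M , λ n M≤n → ℚ.≤-trans (b≤Kc n) (subst (K ℚ.* c n ℚ.≤_) Kδ≡ε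
       (ℚ.*-monoˡ-≤-nonNeg K {{ℚ.nonNegative (ℚ.<⇒≤ 0<K)}}
         (ℚ.≤-trans (recip-anti {suc M} {suc n} (s≤s M≤n)) cM≤δ)))

-- Limits of real sequences

infix 4 _⇝_

-- Convergence tested directly on the representing sequences, both read at the same index N. This
-- drops the second tolerance hidden in `_≤_` and reduces limits to rational estimates; the
-- threshold `N₀` may depend on n.
_⇝_ : (ℕ → ℝ) → ℝ → Set
a ⇝ L = ∀ ε → 0ℚ ℚ.< ε → ∃ λ M → ∀ n → M ℕ.≤ n →
  ∃ λ N₀ → ∀ N → N₀ ℕ.≤ N → ℚ.∣ seq (a n) N ℚ.- seq L N ∣ ℚ.≤ ε

⇝⇒⟶ : ∀ {a L} → a ⇝ L → a ⟶ L
⇝⇒⟶ a⇝L ε 0<ε =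
  let M , h = a⇝L ε 0<ε
  in M , λ n M≤n ε′ 0<ε′ →
     let N₀ , k = h n M≤n
     in N₀ , λ N N₀≤N → ℚ.≤-trans (k N N₀≤N) (p≤p+q ε (ℚ.<⇒≤ 0<ε′))

⇝-shift : ∀ {a L} m → a ⇝ L → (λ n → a (m ℕ.+ n)) ⇝ L
⇝-shift m a⇝L ε 0<ε =
  let M , h = a⇝L ε 0<ε
  in M , λ n M≤n → h (m ℕ.+ n) (ℕ.≤-trans M≤n (ℕ.m≤n+m n m))

⇝-respʳ : ∀ {a x y} → (∀ N → seq x N ≡ seq y N) → a ⇝ x → a ⇝ y
⇝-respʳ {a} x≡y a⇝x ε 0<ε =
  let M , h = a⇝x ε 0<ε
  in M , λ n M≤n →
     let N₀ , k = h n M≤n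
     in N₀ , λ N N₀≤N → subst (λ q → ℚ.∣ seq (a n) N ℚ.- q ∣ ℚ.≤ ε) (x≡y N) (k N N₀≤N)

⇝-perturb : ∀ {a b : ℕ → ℝ} {L} → a ⇝ L →
  (∀ ε → 0ℚ ℚ.< ε → ∃ λ M → ∀ n → M ℕ.≤ n →
    ∃ λ N₀ → ∀ N → N₀ ℕ.≤ N → ℚ.∣ seq (b n) N ℚ.- seq (a n) N ∣ ℚ.≤ ε) →
  b ⇝ L
⇝-perturb {a} {b} {L} a⇝L b~a ε 0<ε =
  let ε/2 = ε ℚ.* ½
      0<ε/2 = 0<* 0<ε 0<½
      M₁ , h₁ = b~a ε/2 0<ε/2
      M₂ , h₂ = a⇝L ε/2 0<ε/2
  in M₁ ℕ.⊔ M₂ , λ n M≤n →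
     let N₁ , k₁ = h₁ n (ℕ.m⊔n≤o⇒m≤o M₁ M₂ M≤n)
         N₂ , k₂ = h₂ n (ℕ.m⊔n≤o⇒n≤o M₁ M₂ M≤n)
     in N₁ ℕ.⊔ N₂ , λ N N₀≤N → subst (_ ℚ.≤_) (half+half ε)
          (∣-∣-triangle (seq (b n) N) (seq (a n) N) (seq L N)
            (k₁ N (ℕ.m⊔n≤o⇒m≤o N₁ N₂ N₀≤N))
            (k₂ N (ℕ.m⊔n≤o⇒n≤o N₁ N₂ N₀≤N)))

-- Write ab - xy = a(b - y) + y(a - x); being within 1 of x, a satisfies |a| ≤ A + 1.
∣ab-xy∣≤ : ∀ {a b x y A B δ} → 0ℚ ℚ.≤ δ → ℚ.∣ x ∣ ℚ.≤ A → ℚ.∣ y ∣ ℚ.≤ B →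
  ℚ.∣ a ℚ.- x ∣ ℚ.≤ 1ℚ → ℚ.∣ a ℚ.- x ∣ ℚ.≤ δ → ℚ.∣ b ℚ.- y ∣ ℚ.≤ δ →
  ℚ.∣ a ℚ.* b ℚ.- x ℚ.* y ∣ ℚ.≤ (A ℚ.+ 1ℚ ℚ.+ B) ℚ.* δ
∣ab-xy∣≤ {a} {b} {x} {y} {A} {B} {δ} 0≤δ x≤A y≤B a-x≤1 a-x≤δ b-y≤δ = begin
  ℚ.∣ a ℚ.* b ℚ.- x ℚ.* y ∣
    ≡⟨ cong ℚ.∣_∣ (QS.solve 4 (λ a b x y → a QS.:* b QS.:+ (QS.:- (x QS.:* y))
         QS.:= a QS.:* (b QS.:+ (QS.:- y)) QS.:+ y QS.:* (a QS.:+ (QS.:- x))) refl a b x y) ⟩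
  ℚ.∣ a ℚ.* (b ℚ.- y) ℚ.+ y ℚ.* (a ℚ.- x) ∣
    ≤⟨ ℚ.∣p+q∣≤∣p∣+∣q∣ (a ℚ.* (b ℚ.- y)) (y ℚ.* (a ℚ.- x)) ⟩
  ℚ.∣ a ℚ.* (b ℚ.- y) ∣ ℚ.+ ℚ.∣ y ℚ.* (a ℚ.- x) ∣
    ≡⟨ cong₂ ℚ._+_ (ℚ.∣p*q∣≡∣p∣*∣q∣ a (b ℚ.- y)) (ℚ.∣p*q∣≡∣p∣*∣q∣ y (a ℚ.- x)) ⟩
  ℚ.∣ a ∣ ℚ.* ℚ.∣ b ℚ.- y ∣ ℚ.+ ℚ.∣ y ∣ ℚ.* ℚ.∣ a ℚ.- x ∣
    ≤⟨ ℚ.+-mono-≤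
         (*-mono (ℚ.0≤∣p∣ a) 0≤δ (ℚ.≤-trans (∣∣-tri a x) (ℚ.+-mono-≤ x≤A a-x≤1)) b-y≤δ)
         (*-mono (ℚ.0≤∣p∣ y) 0≤δ y≤B a-x≤δ) ⟩
  (A ℚ.+ 1ℚ) ℚ.* δ ℚ.+ B ℚ.* δ
    ≡⟨ sym (ℚ.*-distribʳ-+ δ (A ℚ.+ 1ℚ) B) ⟩
  (A ℚ.+ 1ℚ ℚ.+ B) ℚ.* δ ∎
  where open ℚ.≤-Reasoning

⇝-* : ∀ {a b x y} → a ⇝ x → b ⇝ y → (λ n → a n * b n) ⇝ (x * y)
⇝-* {a} {b} {x} {y} a⇝x b⇝y ε 0<ε =
  let A , 0<A , N₁ , x≤A = eventuallyBounded x
      B , 0<B , N₂ , y≤B = eventuallyBounded y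
      δ , 0<δ , Cδ≡ε = ∃-scaled (A ℚ.+ 1ℚ ℚ.+ B) (ℚ.+-mono-< (ℚ.+-mono-< 0<A 0<1) 0<B) ε 0<ε
      M₁ , h₁ = a⇝x 1ℚ 0<1
      M₂ , h₂ = a⇝x δ 0<δ
      M₃ , h₃ = b⇝y δ 0<δ
      M₂₃ = M₂ ℕ.⊔ M₃
      N₁₂ = N₁ ℕ.⊔ N₂
  in M₁ ℕ.⊔ M₂₃ , λ n M≤n →
     let M₂₃≤n = ℕ.m⊔n≤o⇒n≤o M₁ M₂₃ M≤n
         N₃ , k₁ = h₁ n (ℕ.m⊔n≤o⇒m≤o M₁ M₂₃ M≤n)
         N₄ , k₂ = h₂ n (ℕ.m⊔n≤o⇒m≤o M₂ M₃ M₂₃≤n)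
         N₅ , k₃ = h₃ n (ℕ.m⊔n≤o⇒n≤o M₂ M₃ M₂₃≤n)
         N₄₅ = N₄ ℕ.⊔ N₅
         N₃₄₅ = N₃ ℕ.⊔ N₄₅
     in N₁₂ ℕ.⊔ N₃₄₅ , λ N N₀≤N →
        let N₁₂≤N = ℕ.m⊔n≤o⇒m≤o N₁₂ N₃₄₅ N₀≤N
            N₃₄₅≤N = ℕ.m⊔n≤o⇒n≤o N₁₂ N₃₄₅ N₀≤N
            N₄₅≤N = ℕ.m⊔n≤o⇒n≤o N₃ N₄₅ N₃₄₅≤N
        in subst (_ ℚ.≤_) Cδ≡ε (∣ab-xy∣≤ {seq (a n) N} {seq (b n) N} (ℚ.<⇒≤ 0<δ)
             (x≤A N (ℕ.m⊔n≤o⇒m≤o N₁ N₂ N₁₂≤N))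
             (y≤B N (ℕ.m⊔n≤o⇒n≤o N₁ N₂ N₁₂≤N))
             (k₁ N (ℕ.m⊔n≤o⇒m≤o N₃ N₄₅ N₃₄₅≤N))
             (k₂ N (ℕ.m⊔n≤o⇒m≤o N₄ N₅ N₄₅≤N))
             (k₃ N (ℕ.m⊔n≤o⇒n≤o N₄ N₅ N₄₅≤N)))

-- The range n ≤ N is all that the diagonal uses. For M ≥ 1 it keeps out index 0, where the empty
-- partial sum represents ζ(j) - 1 by -1.
UniformlyCauchy : (ℕ → ℝ) → Set
UniformlyCauchy x = ∀ ε → 0ℚ ℚ.< ε → ∃ λ M → ∀ n N → M ℕ.≤ n → n ℕ.≤ N →
  ℚ.∣ seq (x n) N ℚ.- seq (x M) N ∣ ℚ.≤ ε

-- Two diagonal entries are compared through the fixed real `x M`: uniformity costs ε/4 at each end,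
-- and the Cauchy property of `x M` costs ε/2 in between.
diagonal : ∀ x → UniformlyCauchy x → ℝ
diagonal x unif = mkℝ (λ N → seq (x N) N) λ ε 0<ε →
  let ε/2 = ε ℚ.* ½
      0<ε/2 = 0<* 0<ε 0<½
      M , h = unif (ε/2 ℚ.* ½) (0<* 0<ε/2 0<½)
      N₀ , k = cauchy (x M) ε/2 0<ε/2
  in M ℕ.⊔ N₀ , λ m n p q → subst (ℚ.∣ seq (x m) m ℚ.- seq (x n) n ∣ ℚ.≤_)
       (trans (QS.solve 2 (λ a b → a QS.:+ b QS.:+ a QS.:= (a QS.:+ a) QS.:+ b)
                 refl (ε/2 ℚ.* ½) ε/2)
         (trans (cong (ℚ._+ ε/2) (half+half ε/2)) (half+half ε)))
       (∣-∣-triangle (seq (x m) m) (seq (x M) n) (seq (x n) n)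
         (∣-∣-triangle (seq (x m) m) (seq (x M) m) (seq (x M) n)
           (h m m (ℕ.m⊔n≤o⇒m≤o M N₀ p) ℕ.≤-refl)
           (k m n (ℕ.m⊔n≤o⇒n≤o M N₀ p) (ℕ.m⊔n≤o⇒n≤o M N₀ q)))
         (∣-∣-swap (seq (x n) n) (seq (x M) n) (h n n (ℕ.m⊔n≤o⇒m≤o M N₀ q) ℕ.≤-refl)))

⇝-diagonal : ∀ x (unif : UniformlyCauchy x) → x ⇝ diagonal x unif
⇝-diagonal x unif ε 0<ε =
  let M , h = unif (ε ℚ.* ½) (0<* 0<ε 0<½)
  -- Taking `n` itself as the threshold supplies the condition n ≤ N of `unif`.
  in M , λ n M≤n → n , λ N n≤N →
     subst (ℚ.∣ seq (x n) N ℚ.- seq (x N) N ∣ ℚ.≤_) (half+half ε)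
       (∣-∣-triangle (seq (x n) N) (seq (x M) N) (seq (x N) N) (h n N M≤n n≤N)
         (∣-∣-swap (seq (x N) N) (seq (x M) N) (h N N (ℕ.≤-trans M≤n n≤N) ℕ.≤-refl)))

-- Finite sums

seq-∑ : ∀ {P : Pred ℕ 0ℓ} (P? : Decidable P) (f : ∀ n → .(P n) → ℝ) N n →
  seq (∑ P? f n) N ≡ sumℚ (λ j → seq (if-holds (P? j) (f j)) N) n
seq-∑ P? f N zero    = refl
seq-∑ P? f N (suc n) = cong (ℚ._+ seq (if-holds (P? n) (f n)) N) (seq-∑ P? f N n)

sum-cong : ∀ {f g : ℕ → ℚ} → (∀ n → f n ≡ g n) → ∀ N → sumℚ f N ≡ sumℚ g N
sum-cong f≡g zero    = refl
sum-cong f≡g (suc N) = cong₂ ℚ._+_ (sum-cong f≡g N) (f≡g N)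

sum-+ : ∀ f g N → sumℚ (λ n → f n ℚ.+ g n) N ≡ sumℚ f N ℚ.+ sumℚ g N
sum-+ f g zero    = refl
sum-+ f g (suc N) = trans (cong (ℚ._+ (f N ℚ.+ g N)) (sum-+ f g N))
  (QS.solve 4 (λ F G a b → F QS.:+ G QS.:+ (a QS.:+ b) QS.:= (F QS.:+ a) QS.:+ (G QS.:+ b))
    refl (sumℚ f N) (sumℚ g N) (f N) (g N))

sum-suc : ∀ f N → sumℚ f (suc N) ≡ f 0 ℚ.+ sumℚ (λ n → f (suc n)) N
sum-suc f zero    = trans (ℚ.+-identityˡ (f 0)) (sym (ℚ.+-identityʳ (f 0)))
sum-suc f (suc N) = trans (cong (ℚ._+ f (suc N)) (sum-suc f N))
  (ℚ.+-assoc (f 0) (sumℚ (λ n → f (suc n)) N) (f (suc N)))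

sum-close : ∀ {f g e} n → (∀ j → j ℕ.< n → ℚ.∣ f j ℚ.- g j ∣ ℚ.≤ e) →
  ℚ.∣ sumℚ f n ℚ.- sumℚ g n ∣ ℚ.≤ fromℕ n ℚ.* e
sum-close {e = e} zero h = ℚ.≤-reflexive (sym (ℚ.*-zeroˡ e))
sum-close {f} {g} {e} (suc n) h = begin
  ℚ.∣ sumℚ f n ℚ.+ f n ℚ.- (sumℚ g n ℚ.+ g n) ∣
    ≡⟨ cong ℚ.∣_∣ (QS.solve 4 (λ F a G b → F QS.:+ a QS.:+ (QS.:- (G QS.:+ b))
         QS.:= (F QS.:+ (QS.:- G)) QS.:+ (a QS.:+ (QS.:- b)))
         refl (sumℚ f n) (f n) (sumℚ g n) (g n)) ⟩
  ℚ.∣ (sumℚ f n ℚ.- sumℚ g n) ℚ.+ (f n ℚ.- g n) ∣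
    ≤⟨ ℚ.∣p+q∣≤∣p∣+∣q∣ (sumℚ f n ℚ.- sumℚ g n) (f n ℚ.- g n) ⟩
  ℚ.∣ sumℚ f n ℚ.- sumℚ g n ∣ ℚ.+ ℚ.∣ f n ℚ.- g n ∣
    ≤⟨ ℚ.+-mono-≤ (sum-close n (λ j j<n → h j (ℕ.m<n⇒m<1+n j<n))) (h n ℕ.≤-refl) ⟩
  fromℕ n ℚ.* e ℚ.+ e
    ≡⟨ QS.solve 2 (λ n e → n QS.:* e QS.:+ e QS.:= (n QS.:+ QS.con 1ℚ) QS.:* e)
         refl (fromℕ n) e ⟩
  fromℕ (suc n) ℚ.* e ∎
  where open ℚ.≤-Reasoning

-- A Cauchy sequence is bounded from some index on; since the partial sums increase, that bound also
-- covers the earlier ones.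
sum-bounded : ∀ {f} → (∀ n → 0ℚ ℚ.≤ f n) → IsCauchy (sumℚ f) →
  ∃ λ K → 0ℚ ℚ.< K × (∀ N → sumℚ f N ℚ.≤ K)
sum-bounded {f} 0≤f cauchy-f =
  let K , 0<K , N₀ , h = eventuallyBounded (mkℝ (sumℚ f) cauchy-f)
  in K , 0<K , λ N → ℚ.≤-trans (sum-incr {f} 0≤f (ℕ.≤⇒≤′ (ℕ.m≤m⊔n N N₀)))
       (ℚ.≤-trans (p≤∣p∣ (sumℚ f (N ℕ.⊔ N₀))) (h (N ℕ.⊔ N₀) (ℕ.m≤n⊔m N N₀)))

-- Exponential decay of zeta values

recip-cong : ∀ {m n} .{{_ : ℕ.NonZero m}} .{{_ : ℕ.NonZero n}} → m ≡ n → recip m ≡ recip n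
recip-cong refl = refl

ζ-term-+ : ∀ a b m → ζ-term (a ℕ.+ b) m ≡ ζ-term a m ℚ.* ζ-term b m
ζ-term-+ a b m = trans (recip-cong {{ℕ.m^n≢0 (suc m) (a ℕ.+ b)}} (ℕ.^-distribˡ-+-* (suc m) a b))
    (recip-* (suc m ℕ.^ a) (suc m ℕ.^ b))
  where
  instance
    ^a≢0 : ℕ.NonZero (suc m ℕ.^ a)
    ^a≢0 = ℕ.m^n≢0 (suc m) a
    ^b≢0 : ℕ.NonZero (suc m ℕ.^ b)
    ^b≢0 = ℕ.m^n≢0 (suc m) b
    ^*^≢0 : ℕ.NonZero (suc m ℕ.^ a ℕ.* suc m ℕ.^ b)
    ^*^≢0 = ℕ.m*n≢0 (suc m ℕ.^ a) (suc m ℕ.^ b)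

ζ-term-0 : ∀ k → ζ-term k 0 ≡ 1ℚ
ζ-term-0 k = recip-cong {{ℕ.m^n≢0 1 k}} (ℕ.^-zeroˡ k)

-- Index 1 stands for the integer 2, so this is 2^(-k). As a zeta term it inherits the power law
-- `ζ-term-+`.
½^ : ℕ → ℚ
½^ k = ζ-term k 1

½^-nonneg : ∀ k → 0ℚ ℚ.≤ ½^ k
½^-nonneg k = ζ-term-nonneg k 1

½^-suc : ∀ k → ½^ (suc k) ≡ ½ ℚ.* ½^ k
½^-suc k = ζ-term-+ 1 k 1

-- The index `suc m` stands for the integer m + 2 ≥ 2, so each surplus factor 1/(m + 2) is at most
-- 1/2.
ζ-term-decay : ∀ a k m → ζ-term (a ℕ.+ k) (suc m) ℚ.≤ ½^ a ℚ.* ζ-term k (suc m)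
ζ-term-decay a k m = subst (ℚ._≤ ½^ a ℚ.* ζ-term k (suc m)) (sym (ζ-term-+ a k (suc m)))
  (ℚ.*-monoʳ-≤-nonNeg (ζ-term k (suc m)) {{ℚ.nonNegative (ζ-term-nonneg k (suc m))}}
    (recip-anti {{ℕ.m^n≢0 2 a}} {{ℕ.m^n≢0 (suc (suc m)) a}}
      (ℕ.^-monoˡ-≤ a (s≤s (s≤s (z≤n {m}))))))

-- Induction: k + 2 ≤ 2(k + 1), and the factor 2 cancels the new 1/2.
fromℕ*½^≤1 : ∀ k → fromℕ (suc k) ℚ.* ½^ k ℚ.≤ 1ℚ
fromℕ*½^≤1 zero    = ℚ.≤-refl
fromℕ*½^≤1 (suc k) = begin
  (n ℚ.+ 1ℚ) ℚ.* ½^ (suc k)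
    ≡⟨ cong ((n ℚ.+ 1ℚ) ℚ.*_) (½^-suc k) ⟩
  (n ℚ.+ 1ℚ) ℚ.* (½ ℚ.* x)
    ≤⟨ ℚ.*-monoʳ-≤-nonNeg (½ ℚ.* x) {{ℚ.nonNegative (0≤* (ℚ.<⇒≤ 0<½) (½^-nonneg k))}}
         (ℚ.+-monoʳ-≤ n (ℚ.+-monoˡ-≤ 1ℚ (fromℕ-nonneg k))) ⟩
  (n ℚ.+ n) ℚ.* (½ ℚ.* x)
    ≡⟨ QS.solve 2 (λ n x → (n QS.:+ n) QS.:* (QS.con ½ QS.:* x) QS.:= n QS.:* x) refl n x ⟩
  n ℚ.* x
    ≤⟨ fromℕ*½^≤1 k ⟩
  1ℚ ∎
  where
  open ℚ.≤-Reasoning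
  n = fromℕ (suc k)
  x = ½^ k

-- Since (k + 1)(k + 2) = k(k + 1) + 2(k + 1), each step halves the previous value and adds (k + 1)
-- 2^(-k) ≤ 1; the bound 2 is the fixed point of x/2 + 1.
fromℕ²*½^≤2 : ∀ k → fromℕ k ℚ.* fromℕ (suc k) ℚ.* ½^ k ℚ.≤ 2ℚ
fromℕ²*½^≤2 zero    = 0≤2
fromℕ²*½^≤2 (suc k) = begin
  (n ℚ.+ 1ℚ) ℚ.* (n ℚ.+ 1ℚ ℚ.+ 1ℚ) ℚ.* ½^ (suc k)
    ≡⟨ cong ((n ℚ.+ 1ℚ) ℚ.* (n ℚ.+ 1ℚ ℚ.+ 1ℚ) ℚ.*_) (½^-suc k) ⟩
  (n ℚ.+ 1ℚ) ℚ.* (n ℚ.+ 1ℚ ℚ.+ 1ℚ) ℚ.* (½ ℚ.* x)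
    ≡⟨ QS.solve 2 (λ n x → let one = QS.con 1ℚ; n′ = n QS.:+ one in
         n′ QS.:* (n′ QS.:+ one) QS.:* (QS.con ½ QS.:* x)
           QS.:= QS.con ½ QS.:* (n QS.:* n′ QS.:* x) QS.:+ n′ QS.:* x) refl n x ⟩
  ½ ℚ.* (n ℚ.* (n ℚ.+ 1ℚ) ℚ.* x) ℚ.+ (n ℚ.+ 1ℚ) ℚ.* x
    ≤⟨ ℚ.+-mono-≤ (ℚ.*-monoˡ-≤-nonNeg ½ (fromℕ²*½^≤2 k)) (fromℕ*½^≤1 k) ⟩
  ½ ℚ.* 2ℚ ℚ.+ 1ℚ
    ≡⟨⟩
  2ℚ ∎
  where
  open ℚ.≤-Reasoning
  n = fromℕ k
  x = ½^ k

-- Turns a bound on (k + 1) p into a bound on p by a multiple of 1/(k + 1).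
*-c-cancel : ∀ k p → p ≡ fromℕ (suc k) ℚ.* p ℚ.* c k
*-c-cancel k p = trans (sym (ℚ.*-identityˡ p)) (trans (cong (ℚ._* p) (sym (c*suc k)))
  (QS.solve 3 (λ n d p → n QS.:* d QS.:* p QS.:= n QS.:* p QS.:* d) refl (fromℕ (suc k)) (c k) p))

½^≤c : ∀ k → ½^ k ℚ.≤ c k
½^≤c k = subst₂ ℚ._≤_ (sym (*-c-cancel k (½^ k))) (ℚ.*-identityˡ (c k))
  (ℚ.*-monoʳ-≤-nonNeg (c k) {{ℚ.nonNegative (c-nonneg k)}} (fromℕ*½^≤1 k))

fromℕ*½^≤2c : ∀ k → fromℕ k ℚ.* ½^ k ℚ.≤ 2ℚ ℚ.* c k
fromℕ*½^≤2c k = subst (ℚ._≤ 2ℚ ℚ.* c k)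
  (sym (trans (*-c-cancel k (fromℕ k ℚ.* ½^ k))
    (cong (ℚ._* c k) (QS.solve 3 (λ m n x → m QS.:* (n QS.:* x) QS.:= n QS.:* m QS.:* x)
      refl (fromℕ (suc k)) (fromℕ k) (½^ k)))))
  (ℚ.*-monoʳ-≤-nonNeg (c k) {{ℚ.nonNegative (c-nonneg k)}} (fromℕ²*½^≤2 k))

-- Partial sums of ζ(k) - 1, over the integers from 2 to N + 1.
ζ-tail : ℕ → ℕ → ℚ
ζ-tail k = sumℚ (λ m → ζ-term k (suc m))

ζ-tail-nonneg : ∀ k N → 0ℚ ℚ.≤ ζ-tail k N
ζ-tail-nonneg k = sum-nonneg (λ m → ζ-term-nonneg k (suc m))

sum-ζ-term : ∀ k N → sumℚ (ζ-term k) (suc N) ≡ 1ℚ ℚ.+ ζ-tail k N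
sum-ζ-term k N = trans (sum-suc (ζ-term k) N) (cong (ℚ._+ ζ-tail k N) (ζ-term-0 k))

ζ-1≡tail : ∀ k N → sumℚ (ζ-term k) (suc N) ℚ.- 1ℚ ≡ ζ-tail k N
ζ-1≡tail k N = trans (cong (ℚ._- 1ℚ) (sum-ζ-term k N))
  (QS.solve 1 (λ t → QS.con 1ℚ QS.:+ t QS.:+ (QS.:- QS.con 1ℚ) QS.:= t) refl (ζ-tail k N))

½^-2+ : ∀ a → ½^ a ≡ (2ℚ ℚ.* 2ℚ) ℚ.* ½^ (2 ℕ.+ a)
½^-2+ a = trans
  (QS.solve 1 (λ x → x QS.:= (QS.con 2ℚ QS.:* QS.con 2ℚ) QS.:* (QS.con ½ QS.:* (QS.con ½ QS.:* x)))
    refl (½^ a))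
  (cong ((2ℚ ℚ.* 2ℚ) ℚ.*_) (sym (trans (½^-suc (suc a)) (cong (½ ℚ.*_) (½^-suc a)))))

½^-3+ : ∀ a → ½^ a ≡ (2ℚ ℚ.* 2ℚ ℚ.* 2ℚ) ℚ.* ½^ (3 ℕ.+ a)
½^-3+ a = trans (½^-2+ a) (trans
  (QS.solve 1 (λ x → (QS.con 2ℚ QS.:* QS.con 2ℚ) QS.:* x
      QS.:= (QS.con 2ℚ QS.:* QS.con 2ℚ QS.:* QS.con 2ℚ) QS.:* (QS.con ½ QS.:* x))
    refl (½^ (2 ℕ.+ a)))
  (cong ((2ℚ ℚ.* 2ℚ ℚ.* 2ℚ) ℚ.*_) (sym (½^-suc (2 ℕ.+ a)))))

-- Two of the k factors 1/m are kept for convergence, and the other k - 2 give 2^(2 - k) = 4 ·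
-- 2^(-k).
ζ-tail≤ : ∀ {K} → (∀ N → sumℚ (ζ-term 2) N ℚ.≤ K) →
  ∀ k N → 2 ℕ.≤ k → ζ-tail k N ℚ.≤ 2ℚ ℚ.* 2ℚ ℚ.* K ℚ.* ½^ k
ζ-tail≤ {K} ζ2≤K (suc (suc a)) N (s≤s (s≤s _)) = begin
    ζ-tail (2 ℕ.+ a) N
      ≤⟨ sum-mono (λ m → subst (λ k → ζ-term k (suc m) ℚ.≤ ½^ a ℚ.* ζ-term 2 (suc m))
           (ℕ.+-comm a 2) (ζ-term-decay a 2 m)) N ⟩
    sumℚ (λ m → ½^ a ℚ.* ζ-term 2 (suc m)) N
      ≡⟨ sum-* (½^ a) (λ m → ζ-term 2 (suc m)) N ⟩
    ½^ a ℚ.* ζ-tail 2 N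
      ≤⟨ ℚ.*-monoˡ-≤-nonNeg (½^ a) {{ℚ.nonNegative (½^-nonneg a)}} tail2≤K ⟩
    ½^ a ℚ.* K
      ≡⟨ cong (ℚ._* K) (½^-2+ a) ⟩
    2ℚ ℚ.* 2ℚ ℚ.* ½^ (2 ℕ.+ a) ℚ.* K
      ≡⟨ QS.solve 3 (λ f x K → f QS.:* x QS.:* K QS.:= f QS.:* K QS.:* x)
           refl (2ℚ ℚ.* 2ℚ) (½^ (2 ℕ.+ a)) K ⟩
    2ℚ ℚ.* 2ℚ ℚ.* K ℚ.* ½^ (2 ℕ.+ a) ∎
  where
  open ℚ.≤-Reasoning
  tail2≤K : ζ-tail 2 N ℚ.≤ K
  tail2≤K = ℚ.≤-trans
    (subst (ζ-tail 2 N ℚ.≤_) (trans (ℚ.+-comm (ζ-tail 2 N) 1ℚ) (sym (sum-ζ-term 2 N)))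
      (p≤p+q (ζ-tail 2 N) 0≤1))
    (ζ2≤K (suc N))

-- The constant unfolds to a partial sum of ζ(2), which must not be evaluated.
abstract
  ζ-tail-bound : ∃ λ K → 0ℚ ℚ.< K × (∀ k N → 2 ℕ.≤ k → ζ-tail k N ℚ.≤ K ℚ.* ½^ k)
  ζ-tail-bound =
    let K , 0<K , ζ2≤K = sum-bounded (ζ-term-nonneg 2) (ζ-cauchy {2} (s≤s (s≤s z≤n)))
    in 2ℚ ℚ.* 2ℚ ℚ.* K , 0<* (ℚ.positive⁻¹ (2ℚ ℚ.* 2ℚ)) 0<K , ζ-tail≤ ζ2≤K

-- Splitting off the terms with n = 1 of the double zeta values

ζ₂-summand-* : ∀ r s m n → ζ₂-summand r s m n ≡ ζ-term r m ℚ.* ζ-term s n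
ζ₂-summand-* r s m n = recip-* (suc m ℕ.^ r) (suc n ℕ.^ s)
  {{ℕ.m^n≢0 (suc m) r}} {{ℕ.m^n≢0 (suc n) s}} {{^*^-nonZero m r n s}}

ζ₂-summand-nonneg : ∀ r s m n → 0ℚ ℚ.≤ ζ₂-summand r s m n
ζ₂-summand-nonneg r s m n = recip-nonneg (suc m ℕ.^ r ℕ.* suc n ℕ.^ s) {{^*^-nonZero m r n s}}

-- The part with n ≥ 2. Both indices move up by one, which preserves n < m: index m stands for the
-- integer m + 2, and the inner integers run from 2 to m + 1.
ζ₂-rest-term : (r s m : ℕ) → ℚ
ζ₂-rest-term r s m = sumℚ (λ n → ζ₂-summand r s (suc m) (suc n)) m

ζ₂-rest : (r s N : ℕ) → ℚ
ζ₂-rest r s = sumℚ (ζ₂-rest-term r s)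

ζ₂-rest-nonneg : ∀ r s N → 0ℚ ℚ.≤ ζ₂-rest r s N
ζ₂-rest-nonneg r s = sum-nonneg (λ m → sum-nonneg (λ n → ζ₂-summand-nonneg r s (suc m) (suc n)) m)

ζ₂-term-suc : ∀ r s m → ζ₂-term r s (suc m) ≡ ζ-term r (suc m) ℚ.+ ζ₂-rest-term r s m
ζ₂-term-suc r s m = trans (sum-suc (ζ₂-summand r s (suc m)) m)
  (cong (ℚ._+ ζ₂-rest-term r s m) (trans (ζ₂-summand-* r s (suc m) 0)
    (trans (cong (ζ-term r (suc m) ℚ.*_) (ζ-term-0 s)) (ℚ.*-identityʳ (ζ-term r (suc m))))))

-- The splitting of ζ(r, s) into ζ(r) - 1 and the rest is exact already for partial sums, so it can
-- be used at each index.
sum-ζ₂-term : ∀ r s N → sumℚ (ζ₂-term r s) (suc N) ≡ ζ-tail r N ℚ.+ ζ₂-rest r s N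
sum-ζ₂-term r s N = trans (sum-suc (ζ₂-term r s) N)
  -- The outer term of index 0 vanishes: no positive n lies below the integer 1.
  (trans (ℚ.+-identityˡ (sumℚ (λ m → ζ₂-term r s (suc m)) N))
    (trans (sum-cong (ζ₂-term-suc r s) N)
      (sum-+ (λ m → ζ-term r (suc m)) (ζ₂-rest-term r s) N)))

ζ₂-summand-decay : ∀ a b m n →
  ζ₂-summand (2 ℕ.+ a) (1 ℕ.+ b) (suc m) (suc n)
    ℚ.≤ ½^ (a ℕ.+ b) ℚ.* ζ₂-summand 2 1 (suc m) (suc n)
ζ₂-summand-decay a b m n = begin
  ζ₂-summand (2 ℕ.+ a) (1 ℕ.+ b) (suc m) (suc n)
    ≡⟨ ζ₂-summand-* (2 ℕ.+ a) (1 ℕ.+ b) (suc m) (suc n) ⟩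
  ζ-term (2 ℕ.+ a) (suc m) ℚ.* ζ-term (1 ℕ.+ b) (suc n)
    ≡⟨ cong₂ (λ r s → ζ-term r (suc m) ℚ.* ζ-term s (suc n)) (ℕ.+-comm 2 a) (ℕ.+-comm 1 b) ⟩
  ζ-term (a ℕ.+ 2) (suc m) ℚ.* ζ-term (b ℕ.+ 1) (suc n)
    ≤⟨ *-mono (ζ-term-nonneg (a ℕ.+ 2) (suc m)) (0≤* (½^-nonneg b) (ζ-term-nonneg 1 (suc n)))
         (ζ-term-decay a 2 m) (ζ-term-decay b 1 n) ⟩
  (½^ a ℚ.* x) ℚ.* (½^ b ℚ.* y)
    ≡⟨ QS.solve 4 (λ p x q y → (p QS.:* x) QS.:* (q QS.:* y)
         QS.:= (p QS.:* q) QS.:* (x QS.:* y)) refl (½^ a) x (½^ b) y ⟩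
  (½^ a ℚ.* ½^ b) ℚ.* (x ℚ.* y)
    ≡⟨ cong₂ ℚ._*_ (sym (ζ-term-+ a b 1)) (sym (ζ₂-summand-* 2 1 (suc m) (suc n))) ⟩
  ½^ (a ℕ.+ b) ℚ.* ζ₂-summand 2 1 (suc m) (suc n) ∎
  where
  open ℚ.≤-Reasoning
  x = ζ-term 2 (suc m)
  y = ζ-term 1 (suc n)

-- The exponents (2, 1) are kept for convergence. The surplus r + s - 3 is spent on powers of 1/2,
-- whence the factor 8.
ζ₂-rest≤ : ∀ {K} → (∀ N → sumℚ (ζ₂-term 2 1) N ℚ.≤ K) →
  ∀ r s N → 2 ℕ.≤ r → 1 ℕ.≤ s → ζ₂-rest r s N ℚ.≤ 2ℚ ℚ.* 2ℚ ℚ.* 2ℚ ℚ.* K ℚ.* ½^ (r ℕ.+ s)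
ζ₂-rest≤ {K} ζ21≤K (suc (suc a)) (suc b) N (s≤s (s≤s _)) _ = begin
    ζ₂-rest (2 ℕ.+ a) (1 ℕ.+ b) N
      ≤⟨ sum-mono (λ m → ℚ.≤-trans (sum-mono (ζ₂-summand-decay a b m) m)
           (ℚ.≤-reflexive (sum-* (½^ (a ℕ.+ b)) (λ n → ζ₂-summand 2 1 (suc m) (suc n)) m))) N ⟩
    sumℚ (λ m → ½^ (a ℕ.+ b) ℚ.* ζ₂-rest-term 2 1 m) N
      ≡⟨ sum-* (½^ (a ℕ.+ b)) (ζ₂-rest-term 2 1) N ⟩
    ½^ (a ℕ.+ b) ℚ.* ζ₂-rest 2 1 N
      ≤⟨ ℚ.*-monoˡ-≤-nonNeg (½^ (a ℕ.+ b)) {{ℚ.nonNegative (½^-nonneg (a ℕ.+ b))}} rest21≤K ⟩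
    ½^ (a ℕ.+ b) ℚ.* K
      ≡⟨ cong (ℚ._* K) (½^-3+ (a ℕ.+ b)) ⟩
    8ℚ ℚ.* ½^ (3 ℕ.+ (a ℕ.+ b)) ℚ.* K
      ≡⟨ QS.solve 3 (λ f x K → f QS.:* x QS.:* K QS.:= f QS.:* K QS.:* x)
           refl 8ℚ (½^ (3 ℕ.+ (a ℕ.+ b))) K ⟩
    8ℚ ℚ.* K ℚ.* ½^ (3 ℕ.+ (a ℕ.+ b))
      ≡⟨ cong (λ k → 8ℚ ℚ.* K ℚ.* ½^ (2 ℕ.+ k)) (sym (ℕ.+-suc a b)) ⟩
    8ℚ ℚ.* K ℚ.* ½^ (2 ℕ.+ (a ℕ.+ suc b)) ∎
  where
  open ℚ.≤-Reasoning
  8ℚ = 2ℚ ℚ.* 2ℚ ℚ.* 2ℚ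
  rest21≤K : ζ₂-rest 2 1 N ℚ.≤ K
  rest21≤K = ℚ.≤-trans
    (subst (ζ₂-rest 2 1 N ℚ.≤_)
      (trans (ℚ.+-comm (ζ₂-rest 2 1 N) (ζ-tail 2 N)) (sym (sum-ζ₂-term 2 1 N)))
      (p≤p+q (ζ₂-rest 2 1 N) (ζ-tail-nonneg 2 N)))
    (ζ21≤K (suc N))

abstract
  -- Opaque because its constant contains a partial sum of ζ(2, 1). One K serves all r and s, so the
  -- bound depends only on r + s.
  ζ₂-rest-bound : ∃ λ K → 0ℚ ℚ.< K ×
    (∀ r s N → 2 ℕ.≤ r → 1 ℕ.≤ s → ζ₂-rest r s N ℚ.≤ K ℚ.* ½^ (r ℕ.+ s))
  ζ₂-rest-bound =
    let K , 0<K , ζ21≤K =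
          sum-bounded (ζ₂-term-nonneg 2 1) (ζ₂-cauchy {2} {1} (s≤s (s≤s z≤n)) (s≤s z≤n))
    in 2ℚ ℚ.* 2ℚ ℚ.* 2ℚ ℚ.* K , 0<* (ℚ.positive⁻¹ (2ℚ ℚ.* 2ℚ ℚ.* 2ℚ)) 0<K , ζ₂-rest≤ ζ21≤K

-- The sums over a residue class

inv-ζ : ℕ → ℝ
inv-ζ n = inv (ζ (2 ℕ.+ n) (s≤s (s≤s z≤n))) (ζ-positive (2 ℕ.+ n) (s≤s (s≤s z≤n)))

inv-ζ⇝1 : inv-ζ ⇝ 1ℝ
inv-ζ⇝1 ε 0<ε =
  let K , 0<K , tail≤ = ζ-tail-bound
      M , h = c-dominated⇒vanishing {λ k → K ℚ.* ½^ k} 0<K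
        (λ k → ℚ.*-monoˡ-≤-nonNeg K {{ℚ.nonNegative (ℚ.<⇒≤ 0<K)}} (½^≤c k)) ε 0<ε
  -- From index 1 on the partial sum contains its first term 1, as `ζ-1≡tail` requires.
  in M , λ n M≤n → 1 , λ where
       (suc N) _ →
         let k = 2 ℕ.+ n
             z = sumℚ (ζ-term k) (suc N)
             0≤tail = ζ-tail-nonneg k N
             z-1≤ε : ℚ.∣ z ℚ.- 1ℚ ∣ ℚ.≤ 1ℚ ℚ.* 1ℚ ℚ.* ε
             z-1≤ε = subst₂ ℚ._≤_
               (trans (sym (ℚ.0≤p⇒∣p∣≡p 0≤tail)) (cong ℚ.∣_∣ (sym (ζ-1≡tail k N))))
               (sym (ℚ.*-identityˡ ε))
               (ℚ.≤-trans (tail≤ k N (s≤s (s≤s z≤n))) (h k (ℕ.≤-trans M≤n (ℕ.m≤n+m n 2))))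
         -- Inversion does not increase distances between numbers that are at least 1; the limit 1
         -- is read as the reciprocal of 1 ⊔ 1.
         in recip-diff 0<1 (subst (1ℚ ℚ.≤_) (sym (sum-ζ-term k N)) (p≤p+q 1ℚ 0≤tail)) ℚ.≤-refl
              ε (ℚ.<⇒≤ 0<ε) z-1≤ε

module _ (d i : ℕ) where
  ζ-1 : ∀ j → .(AtLeast2 d i j) → ℝ
  ζ-1 j p = ζ j (proj₁ p) - 1ℝ

  ζ-1-sum : ℕ → ℝ
  ζ-1-sum = ∑ (atLeast2? d i) ζ-1

  ζ-1-sum-uniformlyCauchy : UniformlyCauchy ζ-1-sum
  ζ-1-sum-uniformlyCauchy ε 0<ε =
    -- The successor makes n ≤ N force N to be positive.
    suc M , λ where
      n (suc N) M<n _ → close n N M<n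
      _ zero (s≤s _) ()
    where
    open ℚ.≤-Reasoning
    K = proj₁ ζ-tail-bound
    0<K = proj₁ (proj₂ ζ-tail-bound)
    0≤K = ℚ.<⇒≤ 0<K
    tail≤ = proj₂ (proj₂ ζ-tail-bound)

    -- Chosen so that `b j` - `b (suc j)` = K 2^(-j), the bound on the j-th term at every positive
    -- index; the telescoping is therefore uniform in N.
    b : ℕ → ℚ
    b j = 2ℚ ℚ.* K ℚ.* ½^ j

    0≤2K = 0≤* 0≤2 0≤K

    0≤b : ∀ j → 0ℚ ℚ.≤ b j
    0≤b j = 0≤* 0≤2K (½^-nonneg j)

    small : ∃ λ M → ∀ n → M ℕ.≤ n → b n ℚ.≤ ε
    small = c-dominated⇒vanishing {b} {2ℚ ℚ.* K} (0<* (ℚ.positive⁻¹ 2ℚ) 0<K)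
      (λ j → ℚ.*-monoˡ-≤-nonNeg (2ℚ ℚ.* K) {{ℚ.nonNegative 0≤2K}} (½^≤c j)) ε 0<ε
    M = proj₁ small

    term-nonneg : ∀ N j (D : Dec (AtLeast2 d i j)) → 0ℚ ℚ.≤ seq (if-holds D (ζ-1 j)) (suc N)
    term-nonneg N j (yes _) = subst (0ℚ ℚ.≤_) (sym (ζ-1≡tail j N)) (ζ-tail-nonneg j N)
    term-nonneg N j (no _)  = ℚ.≤-refl

    term≤ : ∀ N j (D : Dec (AtLeast2 d i j)) →
      seq (if-holds D (ζ-1 j)) (suc N) ℚ.≤ K ℚ.* ½^ j
    term≤ N j (yes (2≤j , _)) = subst (ℚ._≤ K ℚ.* ½^ j) (sym (ζ-1≡tail j N)) (tail≤ j N 2≤j)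
    term≤ N j (no _)          = 0≤* 0≤K (½^-nonneg j)

    term : ℕ → ℕ → ℚ
    term N j = seq (if-holds (atLeast2? d i j) (ζ-1 j)) (suc N)

    step : ∀ N j → term N j ℚ.+ b (suc j) ℚ.≤ b j
    step N j = begin
      term N j ℚ.+ 2ℚ ℚ.* K ℚ.* ½^ (suc j)
        ≡⟨ cong (λ x → term N j ℚ.+ 2ℚ ℚ.* K ℚ.* x) (½^-suc j) ⟩
      term N j ℚ.+ 2ℚ ℚ.* K ℚ.* (½ ℚ.* ½^ j)
        ≤⟨ ℚ.+-monoˡ-≤ (2ℚ ℚ.* K ℚ.* (½ ℚ.* ½^ j)) (term≤ N j (atLeast2? d i j)) ⟩
      K ℚ.* ½^ j ℚ.+ 2ℚ ℚ.* K ℚ.* (½ ℚ.* ½^ j)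
        ≡⟨ QS.solve 2 (λ K x → K QS.:* x QS.:+ QS.con 2ℚ QS.:* K QS.:* (QS.con ½ QS.:* x)
             QS.:= QS.con 2ℚ QS.:* K QS.:* x) refl K (½^ j) ⟩
      2ℚ ℚ.* K ℚ.* ½^ j ∎

    close : ∀ n N → M ℕ.< n →
      ℚ.∣ seq (ζ-1-sum n) (suc N) ℚ.- seq (ζ-1-sum (suc M)) (suc N) ∣ ℚ.≤ ε
    close n N M<n = subst₂ (λ x y → ℚ.∣ x ℚ.- y ∣ ℚ.≤ ε)
      (sym (seq-∑ (atLeast2? d i) ζ-1 (suc N) n))
      (sym (seq-∑ (atLeast2? d i) ζ-1 (suc N) (suc M)))
      (∣-∣-bound
        (begin
          sumℚ (term N) n
            ≤⟨ p≤p+q (sumℚ (term N) n) (0≤b n) ⟩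
          sumℚ (term N) n ℚ.+ b n
            ≤⟨ telescope {term N} {b} (step N) (ℕ.≤⇒≤′ M<n) ⟩
          sumℚ (term N) (suc M) ℚ.+ b (suc M)
            ≤⟨ ℚ.+-monoʳ-≤ (sumℚ (term N) (suc M)) (proj₂ small (suc M) (ℕ.n≤1+n M)) ⟩
          sumℚ (term N) (suc M) ℚ.+ ε ∎)
        (ℚ.≤-trans (sum-incr {term N} (λ j → term-nonneg N j (atLeast2? d i j)) (ℕ.≤⇒≤′ M<n))
          (p≤p+q (sumℚ (term N) n) (ℚ.<⇒≤ 0<ε))))

  -- At equal indices the ζ(r) - 1 parts cancel exactly. Each r < k leaves at most one rest, of size
  -- at most K 2^(-k) because r + (k - r) = k.
  doubleZetaSum≈ζ-1-sum : ∀ {K} → 0ℚ ℚ.< K →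
    (∀ r s N → 2 ℕ.≤ r → 1 ℕ.≤ s → ζ₂-rest r s N ℚ.≤ K ℚ.* ½^ (r ℕ.+ s)) →
    ∀ k N → ℚ.∣ seq (doubleZetaSum d i k) (suc N) ℚ.- seq (ζ-1-sum k) (suc N) ∣
              ℚ.≤ fromℕ k ℚ.* (K ℚ.* ½^ k)
  doubleZetaSum≈ζ-1-sum {K} 0<K rest≤ k N =
    subst₂ (λ x y → ℚ.∣ x ℚ.- y ∣ ℚ.≤ fromℕ k ℚ.* e)
      (sym (seq-∑ (inRange? d i k) ζ₂-at (suc N) k))
      (sym (seq-∑ (atLeast2? d i) ζ-1 (suc N) k))
      (sum-close k (λ r r<k → close r r<k (inRange? d i k r) (atLeast2? d i r)))
    where
    e = K ℚ.* ½^ k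
    0≤e = 0≤* (ℚ.<⇒≤ 0<K) (½^-nonneg k)

    ζ₂-at : ∀ r → .(InRange d i k r) → ℝ
    ζ₂-at r p = ζ₂ r (k ℕ.∸ r) (proj₁ p) (ℕ.m<n⇒0<n∸m (proj₁ (proj₂ p)))

    close : ∀ r → r ℕ.< k → (D : Dec (InRange d i k r)) (E : Dec (AtLeast2 d i r)) →
      ℚ.∣ seq (if-holds D (ζ₂-at r)) (suc N) ℚ.- seq (if-holds E (ζ-1 r)) (suc N) ∣ ℚ.≤ e
    close r r<k (yes (2≤r , _)) (yes _) =
      subst₂ (λ x y → ℚ.∣ x ℚ.- y ∣ ℚ.≤ e)
        (sym (sum-ζ₂-term r (k ℕ.∸ r) N)) (sym (ζ-1≡tail r N))
        (∣-∣-bound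
          (ℚ.+-monoʳ-≤ (ζ-tail r N)
            (subst (λ l → ζ₂-rest r (k ℕ.∸ r) N ℚ.≤ K ℚ.* ½^ l) (ℕ.m+[n∸m]≡n (ℕ.<⇒≤ r<k))
              (rest≤ r (k ℕ.∸ r) N 2≤r (ℕ.m<n⇒0<n∸m r<k))))
          (ℚ.≤-trans (p≤p+q (ζ-tail r N) (ζ₂-rest-nonneg r (k ℕ.∸ r) N))
            (p≤p+q (ζ-tail r N ℚ.+ ζ₂-rest r (k ℕ.∸ r) N) 0≤e)))
    close r r<k (no _) (no _) = ∣p-p∣≤ 0ℚ 0≤e
    -- For r < k both index conditions coincide, so the decisions cannot disagree.
    close r r<k (yes (2≤r , _ , r≡i)) (no ¬q) = ⊥-elim (¬q (2≤r , r≡i))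
    close r r<k (no ¬p) (yes (2≤r , r≡i)) = ⊥-elim (¬p (2≤r , r<k , r≡i))

  doubleZetaSum⇝ : ∀ {L} → ζ-1-sum ⇝ L → doubleZetaSum d i ⇝ L
  doubleZetaSum⇝ {L} ζ-1⇝L = ⇝-perturb {ζ-1-sum} {doubleZetaSum d i} {L} ζ-1⇝L λ ε 0<ε →
    let K , 0<K , rest≤ = ζ₂-rest-bound
        -- The total error k K 2^(-k) is at most 2K/(k + 1).
        M , h = c-dominated⇒vanishing {λ k → fromℕ k ℚ.* (K ℚ.* ½^ k)} {K ℚ.* 2ℚ}
          (0<* 0<K (ℚ.positive⁻¹ 2ℚ))
          (λ k → subst₂ ℚ._≤_
            (QS.solve 3 (λ n K x → K QS.:* (n QS.:* x) QS.:= n QS.:* (K QS.:* x))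
              refl (fromℕ k) K (½^ k))
            (sym (ℚ.*-assoc K 2ℚ (c k)))
            (ℚ.*-monoˡ-≤-nonNeg K {{ℚ.nonNegative (ℚ.<⇒≤ 0<K)}} (fromℕ*½^≤2c k)))
          ε 0<ε
    in M , λ k M≤k → 1 , λ where
         (suc N) _ → ℚ.≤-trans (doubleZetaSum≈ζ-1-sum 0<K rest≤ k N) (h k M≤k)

theorem6 : (d i : ℕ) → 2 ℕ.≤ d → i ℕ.< d →
    ∃ λ (L : ℝ) →
    SumsTo (atLeast2? d i) (λ j p → ζ j (proj₁ p) - 1ℝ) L ×
    ((λ n → normalisedSum d i (2 ℕ.+ n) (s≤s (s≤s z≤n))) ⟶ L)
theorem6 d i _ _ = L , ⇝⇒⟶ {ζ-1-sum d i} {L} ζ-1⇝L , ⇝⇒⟶ {quotient} {L}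
    -- The product rule gives the limit `1ℝ * L`, which agrees with `L` entry by entry.
    (⇝-respʳ {quotient} {1ℝ * L} {L} (λ N → ℚ.*-identityˡ (seq L N))
      (⇝-* {inv-ζ} {λ n → doubleZetaSum d i (2 ℕ.+ n)} {1ℝ} {L} inv-ζ⇝1
        (⇝-shift {doubleZetaSum d i} {L} 2 (doubleZetaSum⇝ d i {L} ζ-1⇝L))))
  where
  L = diagonal (ζ-1-sum d i) (ζ-1-sum-uniformlyCauchy d i)
  ζ-1⇝L = ⇝-diagonal (ζ-1-sum d i) (ζ-1-sum-uniformlyCauchy d i)
  quotient : ℕ → ℝ
  quotient n = inv-ζ n * doubleZetaSum d i (2 ℕ.+ n)
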